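{- Let $G$ be a simple connected undirected graph with $n\ge 2$ vertices and average resistance degrees $\overline{R}_1,\dots,\overline{R}_n$. Then $$\rho_1(G)\le\max_{i\ne j}\sqrt{\overline{R}_i\,\overline{R}_j},$$ and equality holds if and only if $G$ is pseudo resistance regular.
   Context: For a connected graph $G$ with vertices $v_1,\dots,v_n$, Laplacian matrix $L$ (degree matrix minus adjacency matrix) and Moore-Penrose inverse $L^\dagger=(l^\dagger_{ij})$, the resistance distance is $r_{ij}=l^\dagger_{ii}+l^\dagger_{jj}-2l^\dagger_{ij}$, and the resistance distance matrix is $R(G)=(r_{ij})_{n\times n}$. The resistance degrees are $R_i=\sum_{j=1}^n r_{ij}$, the second resistance degrees are $T_i=\sum_{j=1}^n r_{ij}R_j$, and the average resistance degrees are $\overline{R}_i=T_i/R_i$. $G$ is pseudo resistance regular if there is a constant $k$ with $T_i/R_i=k$ for all $i$. The resistance spectral radius $\rho_1(G)$ is the largest eigenvalue of $R(G)$ (equivalently, the maximum of the absolute values of its eigenvalues). The maximum is over $i,j\in\{1,\dots,n\}$ with $i\ne j$. -}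

module Defs where

open import Algebra.Bundles using (CommutativeMonoid)
open import Algebra.Bundles.Raw using (RawMonoid)
import Algebra.Definitions.RawMonoid as RawMonoidDefs
import Algebra.Properties.CommutativeSemigroup
  as CommutativeSemigroupProperties
open import Data.Bool using (if_then_else_)
open import Data.Fin using (Fin)
import Data.Fin.Properties as Fin
open import Data.Nat as ℕ using (ℕ)
import Data.Nat.Properties as ℕ
import Data.Integer as ℤ
open import Data.Product using (Σ; ∃-syntax; _×_; _,_)
open import Data.Rational
open import Data.Rational.Properties
open import Data.Vec.Functional using (Vector)
open import Level using (0ℓ)
open import Relation.Binary using (Rel; Decidable; Symmetric; Irreflexive)
open import Relation.Binary.Construct.Closure.ReflexiveTransitive using (Star)
open import Relation.Binary.PropositionalEquality
open import Relation.Nullary using (¬_; yes; no; does)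
open import Relation.Unary using (Pred)

------------------------------------------------------------------------
-- Real numbers: Cauchy sequences of rationals, with setoid equality _≈ᴿ_.
-- The ring operations are termwise.

IsCauchy : (ℕ → ℚ) → Set
IsCauchy a = ∀ ε → 0ℚ < ε →
  ∃[ N ] (∀ m n → N ℕ.≤ m → N ℕ.≤ n → ∣ a m - a n ∣ < ε)

record ℝ : Set where
  constructor mkℝ
  field
    seq    : ℕ → ℚ
    cauchy : IsCauchy seq

open ℝ public

infix  4 _≈ᴿ_ _≤ᴿ_
infixl 6 _+ᴿ_
infixl 7 _*ᴿ_

record _≈ᴿ_ (x y : ℝ) : Set where
  constructor mk≈
  field
    close : ∀ ε → 0ℚ < ε →
      ∃[ N ] (∀ n → N ℕ.≤ n → ∣ seq x n - seq y n ∣ < ε)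

record _≤ᴿ_ (x y : ℝ) : Set where
  constructor mk≤
  field
    below : ∀ ε → 0ℚ < ε → ∃[ N ] (∀ n → N ℕ.≤ n → seq x n < seq y n + ε)

open _≈ᴿ_ public
open _≤ᴿ_ public

tolerance : ∀ B ε → 0ℚ < B → 0ℚ < ε → ∃[ δ ] (0ℚ < δ × B * δ ≡ ε)
tolerance B ε 0<B 0<ε = 1/ B * ε , positive⁻¹ (1/ B * ε) , (begin
    B * (1/ B * ε)  ≡⟨ *-assoc B (1/ B) ε ⟨
    B * 1/ B * ε    ≡⟨ cong (_* ε) (*-inverseʳ B) ⟩
    1ℚ * ε          ≡⟨ *-identityˡ ε ⟩
    ε               ∎)
  where
  open ≡-Reasoning
  instance
    B⁺ : Positive B
    B⁺ = positive 0<B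
    B≢0 : NonZero B
    B≢0 = pos⇒nonZero B
    prod⁺ : Positive (1/ B * ε)
    prod⁺ = pos*pos⇒pos (1/ B) {{1/pos⇒pos B}} ε {{positive 0<ε}}

halve : ∀ ε → 0ℚ < ε → ∃[ δ ] (0ℚ < δ × δ + δ ≡ ε)
halve ε 0<ε = ½ * ε
  , positive⁻¹ (½ * ε) {{pos*pos⇒pos ½ ε {{positive 0<ε}}}}
  , trans (sym (*-distribʳ-+ ε ½ ½)) (*-identityˡ ε)

+-interchange : ∀ p q r s → (p + q) + (r + s) ≡ (p + r) + (q + s)
+-interchange = interchange
  where
  open CommutativeSemigroupProperties
    (CommutativeMonoid.commutativeSemigroup +-0-commutativeMonoid)

p≡[p-q]+q : ∀ p q → p ≡ (p - q) + q
p≡[p-q]+q p q = sym (trans (+-assoc p (- q) q)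
  (trans (cong (p +_) (+-inverseˡ q)) (+-identityʳ p)))

*-distribˡ-- : ∀ p q r → p * (q - r) ≡ p * q - p * r
*-distribˡ-- p q r = trans (*-distribˡ-+ p q (- r))
  (cong (p * q +_) (sym (neg-distribʳ-* p r)))

∣+-+∣< : ∀ p q r s {γ δ} → ∣ p - r ∣ < γ → ∣ q - s ∣ < δ →
  ∣ (p + q) - (r + s) ∣ < γ + δ
∣+-+∣< p q r s {γ} {δ} h k = begin-strict
  ∣ (p + q) - (r + s) ∣
    ≡⟨ cong ∣_∣ (trans (cong (p + q +_) (neg-distrib-+ r s))
         (+-interchange p q (- r) (- s))) ⟩
  ∣ (p - r) + (q - s) ∣    ≤⟨ ∣p+q∣≤∣p∣+∣q∣ (p - r) (q - s) ⟩
  ∣ p - r ∣ + ∣ q - s ∣    <⟨ +-mono-< h k ⟩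
  γ + δ                    ∎
  where open ≤-Reasoning

∣*∣< : ∀ C p q γ → 0ℚ < C → ∣ p ∣ ≤ C → ∣ q ∣ < γ → ∣ p * q ∣ < C * γ
∣*∣< C p q γ 0<C ∣p∣≤C ∣q∣<γ = begin-strict
  ∣ p * q ∣      ≡⟨ ∣p*q∣≡∣p∣*∣q∣ p q ⟩
  ∣ p ∣ * ∣ q ∣  ≤⟨ *-monoʳ-≤-nonNeg ∣ q ∣ {{∣-∣-nonNeg q}} ∣p∣≤C ⟩
  C * ∣ q ∣      <⟨ *-monoʳ-<-pos C {{positive 0<C}} ∣q∣<γ ⟩
  C * γ          ∎
  where open ≤-Reasoning

*-difference : ∀ p q r s → p * q - r * s ≡ p * (q - s) + s * (p - r)
*-difference p q r s = sym (begin
  p * (q - s) + s * (p - r)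
    ≡⟨ cong₂ _+_ (*-distribˡ-- p q s) (*-distribˡ-- s p r) ⟩
  (p * q - p * s) + (s * p - s * r)
    ≡⟨ cong₂ (λ t u → (p * q - p * s) + (t - u)) (*-comm s p) (*-comm s r) ⟩
  (p * q - p * s) + (p * s - r * s)
    ≡⟨ +-assoc (p * q - p * s) (p * s) (- (r * s)) ⟨
  ((p * q - p * s) + p * s) - r * s
    ≡⟨ cong (_- r * s) (p≡[p-q]+q (p * q) (p * s)) ⟨
  p * q - r * s ∎)
  where open ≡-Reasoning

∣*-*∣< : ∀ p q r s A B α β → 0ℚ < A → 0ℚ < B → ∣ p ∣ ≤ A → ∣ s ∣ ≤ B →
  ∣ q - s ∣ < α → ∣ p - r ∣ < β → ∣ p * q - r * s ∣ < A * α + B * β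
∣*-*∣< p q r s A B α β 0<A 0<B ∣p∣≤A ∣s∣≤B h k = begin-strict
  ∣ p * q - r * s ∣
    ≡⟨ cong ∣_∣ (*-difference p q r s) ⟩
  ∣ p * (q - s) + s * (p - r) ∣
    ≤⟨ ∣p+q∣≤∣p∣+∣q∣ (p * (q - s)) (s * (p - r)) ⟩
  ∣ p * (q - s) ∣ + ∣ s * (p - r) ∣
    <⟨ +-mono-< (∣*∣< A p (q - s) α 0<A ∣p∣≤A h)
         (∣*∣< B s (p - r) β 0<B ∣s∣≤B k) ⟩
  A * α + B * β ∎
  where open ≤-Reasoning

eventually-bounded : ∀ a → IsCauchy a →
  ∃[ B ] (0ℚ < B × ∃[ N ] (∀ n → N ℕ.≤ n → ∣ a n ∣ ≤ B))
eventually-bounded a ca =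
  let N , h = ca 1ℚ (positive⁻¹ 1ℚ) in
  1ℚ + ∣ a N ∣
  , positive⁻¹ (1ℚ + ∣ a N ∣) {{pos+nonNeg⇒pos 1ℚ ∣ a N ∣ {{∣-∣-nonNeg (a N)}}}}
  , N , λ n N≤n → bound (a n) (a N) (h n N N≤n ℕ.≤-refl)
  where
  open ≤-Reasoning
  bound : ∀ p q → ∣ p - q ∣ < 1ℚ → ∣ p ∣ ≤ 1ℚ + ∣ q ∣
  bound p q h = begin
    ∣ p ∣                ≡⟨ cong ∣_∣ (p≡[p-q]+q p q) ⟩
    ∣ (p - q) + q ∣      ≤⟨ ∣p+q∣≤∣p∣+∣q∣ (p - q) q ⟩
    ∣ p - q ∣ + ∣ q ∣    ≤⟨ +-monoˡ-≤ ∣ q ∣ (<⇒≤ h) ⟩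
    1ℚ + ∣ q ∣           ∎

-- Abstract so that comparing reals never unfolds convergence proofs.
abstract
  const-cauchy : ∀ q → IsCauchy (λ _ → q)
  const-cauchy q ε 0<ε = 0 , λ _ _ _ _ →
    subst (λ t → ∣ t ∣ < ε) (sym (+-inverseʳ q)) 0<ε

  +-cauchy : ∀ a b → IsCauchy a → IsCauchy b → IsCauchy (λ n → a n + b n)
  +-cauchy a b ca cb ε 0<ε =
    let δ , 0<δ , δ+δ≡ε = halve ε 0<ε
        M , hM = ca δ 0<δ
        N , hN = cb δ 0<δ
    in M ℕ.⊔ N , λ m n p q →
      subst (∣ (a m + b m) - (a n + b n) ∣ <_) δ+δ≡ε
        (∣+-+∣< (a m) (b m) (a n) (b n)
          (hM m n (ℕ.m⊔n≤o⇒m≤o M N p) (ℕ.m⊔n≤o⇒m≤o M N q))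
          (hN m n (ℕ.m⊔n≤o⇒n≤o M N p) (ℕ.m⊔n≤o⇒n≤o M N q)))

  *-cauchy : ∀ a b → IsCauchy a → IsCauchy b → IsCauchy (λ n → a n * b n)
  *-cauchy a b ca cb ε 0<ε =
    let δ , 0<δ , δ+δ≡ε = halve ε 0<ε
        A , 0<A , M₁ , hA = eventually-bounded a ca
        B , 0<B , N₁ , hB = eventually-bounded b cb
        α , 0<α , Aα≡δ = tolerance A δ 0<A 0<δ
        β , 0<β , Bβ≡δ = tolerance B δ 0<B 0<δ
        M₂ , hM = ca β 0<β
        N₂ , hN = cb α 0<α
        M = M₁ ℕ.⊔ M₂
        N = N₁ ℕ.⊔ N₂
    in M ℕ.⊔ N , λ m n p q →
      let pM = ℕ.m⊔n≤o⇒m≤o M N p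
          pN = ℕ.m⊔n≤o⇒n≤o M N p
          qM = ℕ.m⊔n≤o⇒m≤o M N q
          qN = ℕ.m⊔n≤o⇒n≤o M N q
      in subst (∣ a m * b m - a n * b n ∣ <_)
        (trans (cong₂ _+_ Aα≡δ Bβ≡δ) δ+δ≡ε)
        (∣*-*∣< (a m) (b m) (a n) (b n) A B α β 0<A 0<B
          (hA m (ℕ.m⊔n≤o⇒m≤o M₁ M₂ pM)) (hB n (ℕ.m⊔n≤o⇒m≤o N₁ N₂ qN))
          (hN m n (ℕ.m⊔n≤o⇒n≤o N₁ N₂ pN) (ℕ.m⊔n≤o⇒n≤o N₁ N₂ qN))
          (hM m n (ℕ.m⊔n≤o⇒n≤o M₁ M₂ pM) (ℕ.m⊔n≤o⇒n≤o M₁ M₂ qM)))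

fromℚ : ℚ → ℝ
fromℚ q = mkℝ (λ _ → q) (const-cauchy q)

0ᴿ : ℝ
0ᴿ = fromℚ 0ℚ

_+ᴿ_ : ℝ → ℝ → ℝ
x +ᴿ y = mkℝ (λ n → seq x n + seq y n)
  (+-cauchy (seq x) (seq y) (cauchy x) (cauchy y))

_*ᴿ_ : ℝ → ℝ → ℝ
x *ᴿ y = mkℝ (λ n → seq x n * seq y n)
  (*-cauchy (seq x) (seq y) (cauchy x) (cauchy y))

+ᴿ-0-rawMonoid : RawMonoid 0ℓ 0ℓ
+ᴿ-0-rawMonoid = record { Carrier = ℝ ; _≈_ = _≈ᴿ_ ; _∙_ = _+ᴿ_ ; ε = 0ᴿ }

open RawMonoidDefs +-0-rawMonoid public using (sum)
open RawMonoidDefs +ᴿ-0-rawMonoid public using () renaming (sum to sumᴿ)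

-- s = √a
IsSqrt : ℝ → ℝ → Set
IsSqrt a s = 0ᴿ ≤ᴿ s × s *ᴿ s ≈ᴿ a

IsMaximum : Pred ℝ 0ℓ → ℝ → Set
IsMaximum S m = S m × (∀ s → S s → s ≤ᴿ m)

------------------------------------------------------------------------
-- Rational matrices

Matrix : ℕ → Set
Matrix n = Fin n → Fin n → ℚ

infixl 7 _⊗_
infix  4 _≐_

_≐_ : ∀ {n} → Rel (Matrix n) 0ℓ
A ≐ B = ∀ i j → A i j ≡ B i j

_⊗_ : ∀ {n} → Matrix n → Matrix n → Matrix n
(A ⊗ B) i j = sum (λ k → A i k * B k j)

_ᵀ : ∀ {n} → Matrix n → Matrix n
(A ᵀ) i j = A j i

-- The four Penrose equations. They have at most one real solution X, and
-- for a rational matrix A that solution is rational, so taking X over ℚ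
-- loses nothing.
record IsMoorePenroseInverse {n} (A X : Matrix n) : Set where
  field
    AXA≐A    : A ⊗ X ⊗ A ≐ A
    XAX≐X    : X ⊗ A ⊗ X ≐ X
    AX-selfᵀ : (A ⊗ X) ᵀ ≐ A ⊗ X
    XA-selfᵀ : (X ⊗ A) ᵀ ≐ X ⊗ A

-- Real eigenvalues suffice below: resistance matrices are symmetric.
IsEigenvalue : ∀ {n} → Matrix n → Pred ℝ 0ℓ
IsEigenvalue {n} A μ = Σ (Vector ℝ n) λ x →
  ¬ (∀ i → x i ≈ᴿ 0ᴿ) ×
  (∀ i → sumᴿ (λ j → fromℚ (A i j) *ᴿ x j) ≈ᴿ μ *ᴿ x i)

IsLargestEigenvalue : ∀ {n} → Matrix n → ℝ → Set
IsLargestEigenvalue A = IsMaximum (IsEigenvalue A)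

------------------------------------------------------------------------
-- Graphs and resistance distance

record SimpleGraph (n : ℕ) : Set₁ where
  field
    _~_   : Rel (Fin n) 0ℓ
    _~?_  : Decidable _~_
    ~-sym : Symmetric _~_
    ~-irr : Irreflexive _≡_ _~_

Connected : ∀ {n} → SimpleGraph n → Set
Connected G = ∀ i j → Star (SimpleGraph._~_ G) i j

module _ {n} (G : SimpleGraph n) where
  open SimpleGraph G

  adjacency : Matrix n
  adjacency i j = if does (i ~? j) then 1ℚ else 0ℚ

  degree : Fin n → ℚ
  degree i = sum (adjacency i)

  degreeMatrix : Matrix n
  degreeMatrix i j = if does (i Fin.≟ j) then degree i else 0ℚ

  laplacian : Matrix n
  laplacian i j = degreeMatrix i j - adjacency i j

-- Division with the convention p ÷₀ 0 = 0. The only divisors used are the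
-- resistance degrees, which are positive for connected graphs on at least
-- two vertices.
_÷₀_ : ℚ → ℚ → ℚ
p ÷₀ q with q ≟ 0ℚ
... | yes _   = 0ℚ
... | no  q≢0 = (p ÷ q) {{≢-nonZero q≢0}}

-- L† stands for the Moore–Penrose inverse of the Laplacian.
module _ {n} (L† : Matrix n) where

  resistanceMatrix : Matrix n
  resistanceMatrix i j = L† i i + L† j j - (ℤ.+ 2 / 1) * L† i j

  resistanceDegree : Fin n → ℚ
  resistanceDegree i = sum (resistanceMatrix i)

  secondResistanceDegree : Fin n → ℚ
  secondResistanceDegree i =
    sum (λ j → resistanceMatrix i j * resistanceDegree j)

  averageResistanceDegree : Fin n → ℚ
  averageResistanceDegree i = secondResistanceDegree i ÷₀ resistanceDegree i

  PseudoResistanceRegular : Set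
  PseudoResistanceRegular = ∃[ k ] (∀ i → averageResistanceDegree i ≡ k)

  -- The set of numbers √(R̄ᵢ R̄ⱼ) with i ≠ j.
  GeometricMeans : Pred ℝ 0ℓ
  GeometricMeans s = ∃[ i ] ∃[ j ] (i ≢ j ×
    IsSqrt (fromℚ (averageResistanceDegree i * averageResistanceDegree j)) s)

{-# OPTIONS --safe #-}
module Submission where

-- Let R be the resistance matrix, r the vector of its row sums (the resistance
-- degrees) and ρ i = (R r) i / r i the average resistance degrees. By
-- resistance-sym, resistance-diagonal and resistance-pos, R is symmetric with
-- zero diagonal and positive entries off the diagonal. Positivity holds because
-- the resistance between i and j is the Dirichlet energy of the vector
-- u = L† (e i - e j); were it zero, L would have equal columns i and j, which is
-- impossible because connectedness makes the degree of i positive.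
--
-- For such a matrix, a positive vector z with R z ≤ c z bounds all eigenvalues
-- by c (collatz-wielandt): pair the inequality μ ∣x∣ ≤ R ∣x∣ with z and use
-- symmetry. Let p maximise ρ, let q maximise it among the other indices, and
-- put a = ρ p and b = ρ q. If c ≥ √(ab), the vector z that is c r at p and b r
-- elsewhere satisfies R z ≤ c z, because the diagonal of R is zero. Hence every
-- eigenvalue is at most √(ab), and so at most the maximum m of the geometric
-- means.
--
-- If all ρ i equal k, then m = k, and k is an eigenvalue with eigenvector r, so
-- the largest eigenvalue is m. If they are not all equal, then n ≥ 3, and the
-- test vector can be improved so that it works for some c < √(ab) (gap): when
-- a > b, the vector a r at p and c r elsewhere has room to spare in every row
-- but p; when a = b, the slack of R r ≤ a r spreads to all rows for the vector
-- r + R r. So the largest eigenvalue is less than m.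
--
-- Test vectors, bounds and approximate eigenvectors are kept rational: the
-- Collatz-Wielandt estimate is applied to the terms of the Cauchy sequences of
-- an eigenvector, and c ranges over rational approximations to √(ab). The real
-- number √(ab) itself is needed only to compare it with m (sqrt-exists).

open import Defs
import Algebra.Properties.Semiring.Sum as SemiringSum
open import Algebra.Bundles using (CommutativeRing)
open import Data.Bool using (if_then_else_; true; false)
open import Data.Empty using (⊥-elim)
open import Data.Fin using (Fin; zero; suc; punchIn; punchOut)
import Data.Fin.Properties as Fin
open import Data.Integer as ℤ using (-[1+_])
import Data.Integer.Properties as ℤ
open import Data.Nat as ℕ using (ℕ; zero; suc)
import Data.Nat.Coprimality as Coprimality
import Data.Nat.Properties as ℕ
open import Data.Product using (∃-syntax; _×_; _,_; proj₁; proj₂)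
import Data.Rational.Unnormalised as ℚᵘ
import Data.Rational.Unnormalised.Properties as ℚᵘ
open import Data.Sum using (_⊎_; inj₁; inj₂)
open import Function.Bundles using (_⇔_; mk⇔)
open import Level using (0ℓ)
open import Relation.Binary using (Setoid)
import Relation.Binary.Construct.Closure.ReflexiveTransitive as Star
open import Relation.Binary.PropositionalEquality
import Relation.Binary.Reasoning.Setoid as SetoidReasoning
open import Relation.Nullary using (¬_; yes; no; does)
open import Relation.Nullary.Decidable using (dec-true; dec-false)

-- Inside this module _≤_ is the order of ℚ; in the theorem it is that of ℕ.
module Lemmas where

  open import Data.Rational
  open import Data.Rational.Properties
  open import Data.Rational.Solver using (module +-*-Solver)
  open +-*-Solver
  open SemiringSum (CommutativeRing.semiring +-*-commutativeRing)
    using (sum-cong-≗; ∑-distrib-+; ∑-comm; *-distribˡ-sum; *-distribʳ-sum;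
           sum-replicate-zero)

  -- Order and multiplication in ℚ

  nonneg-+ : ∀ {p q} → 0ℚ ≤ p → 0ℚ ≤ q → 0ℚ ≤ p + q
  nonneg-+ = +-mono-≤

  pos-+ : ∀ {p q} → 0ℚ < p → 0ℚ ≤ q → 0ℚ < p + q
  pos-+ = +-mono-<-≤

  nonneg-* : ∀ {p q} → 0ℚ ≤ p → 0ℚ ≤ q → 0ℚ ≤ p * q
  nonneg-* {p} {q} 0≤p 0≤q = nonNegative⁻¹ (p * q)
    {{nonNeg*nonNeg⇒nonNeg p {{nonNegative 0≤p}} q {{nonNegative 0≤q}}}}

  pos-* : ∀ {p q} → 0ℚ < p → 0ℚ < q → 0ℚ < p * q
  pos-* {p} {q} 0<p 0<q = positive⁻¹ (p * q)
    {{pos*pos⇒pos p {{positive 0<p}} q {{positive 0<q}}}}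

  ≤∧≢⇒< : ∀ {p q} → p ≤ q → p ≢ q → p < q
  ≤∧≢⇒< p≤q p≢q = ≰⇒> (λ q≤p → p≢q (≤-antisym p≤q q≤p))

  *-monoˡ-≤ : ∀ {r p q} → 0ℚ ≤ r → p ≤ q → r * p ≤ r * q
  *-monoˡ-≤ {r} 0≤r = *-monoˡ-≤-nonNeg r {{nonNegative 0≤r}}

  *-monoʳ-≤ : ∀ {r p q} → 0ℚ ≤ r → p ≤ q → p * r ≤ q * r
  *-monoʳ-≤ {r} 0≤r = *-monoʳ-≤-nonNeg r {{nonNegative 0≤r}}

  *-monoˡ-< : ∀ {r p q} → 0ℚ < r → p < q → r * p < r * q
  *-monoˡ-< {r} 0<r = *-monoʳ-<-pos r {{positive 0<r}}

  *-cancelˡ-≤ : ∀ {r p q} → 0ℚ < r → r * p ≤ r * q → p ≤ q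
  *-cancelˡ-≤ {r} 0<r = *-cancelˡ-≤-pos r {{positive 0<r}}

  *-cancelˡ-< : ∀ {r p q} → 0ℚ ≤ r → r * p < r * q → p < q
  *-cancelˡ-< {r} 0≤r = *-cancelˡ-<-nonNeg r {{nonNegative 0≤r}}

  *-mono-≤ : ∀ {p q r s} → 0ℚ ≤ p → 0ℚ ≤ s → p ≤ q → r ≤ s → p * r ≤ q * s
  *-mono-≤ 0≤p 0≤s p≤q r≤s = ≤-trans (*-monoˡ-≤ 0≤p r≤s) (*-monoʳ-≤ 0≤s p≤q)

  -- An inequality certified by exhibiting the gap between its two sides.
  ≤-by : ∀ {p q} e → 0ℚ ≤ e → p + e ≡ q → p ≤ q
  ≤-by {p} e 0≤e eq = subst (p ≤_) eq
    (subst (_≤ p + e) (+-identityʳ p) (+-monoʳ-≤ p 0≤e))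

  <-by : ∀ {p q} e → 0ℚ < e → p + e ≡ q → p < q
  <-by {p} e 0<e eq = subst (p <_) eq
    (subst (_< p + e) (+-identityʳ p) (+-monoʳ-< p 0<e))

  p≤q⇒0≤q-p : ∀ {p q} → p ≤ q → 0ℚ ≤ q - p
  p≤q⇒0≤q-p {p} {q} h = subst (_≤ q - p) (+-inverseʳ p) (+-monoˡ-≤ (- p) h)

  p<q⇒0<q-p : ∀ {p q} → p < q → 0ℚ < q - p
  p<q⇒0<q-p {p} {q} h = subst (_< q - p) (+-inverseʳ p) (+-monoˡ-< (- p) h)

  0≤p*p : ∀ p → 0ℚ ≤ p * p
  0≤p*p p with ∣p∣≡p∨∣p∣≡-p p | nonneg-* (0≤∣p∣ p) (0≤∣p∣ p)
  ... | inj₁ eq | h = subst (λ t → 0ℚ ≤ t * t) eq h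
  ... | inj₂ eq | h = subst (0ℚ ≤_) (solve 1 (λ t → (:- t) :* (:- t) := t :* t) refl p)
    (subst (λ t → 0ℚ ≤ t * t) eq h)

  *-cancel-sq-< : ∀ {p q} → 0ℚ ≤ q → p * p < q * q → p < q
  *-cancel-sq-< {p} {q} 0≤q h with p <? q
  ... | yes p<q = p<q
  ... | no p≮q = ⊥-elim (<-irrefl refl (<-≤-trans h
    (*-mono-≤ 0≤q (≤-trans 0≤q q≤p) q≤p q≤p)))
    where q≤p = ≮⇒≥ p≮q

  *-mono-sq-< : ∀ {p q} → 0ℚ ≤ p → p < q → p * p < q * q
  *-mono-sq-< {p} {q} 0≤p p<q = ≤-<-trans (*-monoˡ-≤ 0≤p (<⇒≤ p<q))
    (subst₂ _<_ (*-comm q p) refl (*-monoˡ-< (≤-<-trans 0≤p p<q) p<q))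

  *-cancel-sq-≤ : ∀ {p q} → 0ℚ ≤ q → p * p ≤ q * q → p ≤ q
  *-cancel-sq-≤ {p} {q} 0≤q h with p ≤? q
  ... | yes p≤q = p≤q
  ... | no p≰q = ⊥-elim (<-irrefl refl (<-≤-trans (*-mono-sq-< 0≤q (≰⇒> p≰q)) h))

  p*p≤0⇒p≡0 : ∀ {p} → p * p ≤ 0ℚ → p ≡ 0ℚ
  p*p≤0⇒p≡0 {p} h = ≤-antisym (*-cancel-sq-≤ ≤-refl h)
    (subst (0ℚ ≤_) (solve 1 (λ p → :- (:- p) := p) refl p)
      (neg-antimono-≤ (*-cancel-sq-≤ { - p} ≤-refl
        (subst (_≤ 0ℚ) (solve 1 (λ p → p :* p := (:- p) :* (:- p)) refl p) h))))

  a*t²≤0⇒a*t≡0 : ∀ {a t} → 0ℚ ≤ a → a * (t * t) ≤ 0ℚ → a * t ≡ 0ℚ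
  a*t²≤0⇒a*t≡0 {a} {t} 0≤a h = p*p≤0⇒p≡0 (subst₂ _≤_
    (solve 2 (λ a t → a :* (a :* (t :* t)) := a :* t :* (a :* t)) refl a t)
    (*-zeroʳ a) (*-monoˡ-≤ 0≤a h))

  -- Finite sums and finite extrema

  sum-mono-≤ : ∀ {n} {f g : Fin n → ℚ} → (∀ i → f i ≤ g i) → sum f ≤ sum g
  sum-mono-≤ {zero} h = ≤-refl
  sum-mono-≤ {suc n} h = +-mono-≤ (h zero) (sum-mono-≤ (λ i → h (suc i)))

  sum-nonneg : ∀ {n} {f : Fin n → ℚ} → (∀ i → 0ℚ ≤ f i) → 0ℚ ≤ sum f
  sum-nonneg {zero} h = ≤-refl
  sum-nonneg {suc n} h = nonneg-+ (h zero) (sum-nonneg (λ i → h (suc i)))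

  term≤sum : ∀ {n} {f : Fin n → ℚ} → (∀ i → 0ℚ ≤ f i) → ∀ k → f k ≤ sum f
  term≤sum {suc n} {f} h zero = ≤-by _ (sum-nonneg (λ i → h (suc i))) refl
  term≤sum {suc n} {f} h (suc k) = ≤-trans (term≤sum (λ i → h (suc i)) k)
    (≤-by (f zero) (h zero) (+-comm _ (f zero)))

  sum-pos : ∀ {n} {f : Fin n → ℚ} → (∀ i → 0ℚ ≤ f i) → ∀ k → 0ℚ < f k → 0ℚ < sum f
  sum-pos h k 0<fk = <-≤-trans 0<fk (term≤sum h k)

  ∣sum∣≤sum∣∣ : ∀ {n} (f : Fin n → ℚ) → ∣ sum f ∣ ≤ sum (λ i → ∣ f i ∣)
  ∣sum∣≤sum∣∣ {zero} f = ≤-refl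
  ∣sum∣≤sum∣∣ {suc n} f = ≤-trans (∣p+q∣≤∣p∣+∣q∣ (f zero) _)
    (+-monoʳ-≤ ∣ f zero ∣ (∣sum∣≤sum∣∣ (λ i → f (suc i))))

  sum-linear : ∀ {n} a b (f g : Fin n → ℚ) →
    sum (λ i → a * f i + b * g i) ≡ a * sum f + b * sum g
  sum-linear a b f g = trans (∑-distrib-+ (λ i → a * f i) (λ i → b * g i))
    (cong₂ _+_ (sym (*-distribˡ-sum a f)) (sym (*-distribˡ-sum b g)))

  sum-minus : ∀ {n} (f g : Fin n → ℚ) → sum (λ i → f i - g i) ≡ sum f - sum g
  sum-minus f g = begin
    sum (λ i → f i - g i)
      ≡⟨ sum-cong-≗ (λ i → solve 2 (λ f g → f :- g := con 1ℚ :* f :+ (:- con 1ℚ) :* g) refl (f i) (g i)) ⟩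
    sum (λ i → 1ℚ * f i + (- 1ℚ) * g i)
      ≡⟨ sum-linear 1ℚ (- 1ℚ) f g ⟩
    1ℚ * sum f + (- 1ℚ) * sum g
      ≡⟨ solve 2 (λ f g → con 1ℚ :* f :+ (:- con 1ℚ) :* g := f :- g) refl (sum f) (sum g) ⟩
    sum f - sum g ∎
    where open ≡-Reasoning

  -- Multiplication of a vector by one row of a diagonal matrix.
  sum-delta : ∀ {n} (i : Fin n) c (v : Fin n → ℚ) →
    sum (λ j → (if does (i Fin.≟ j) then c else 0ℚ) * v j) ≡ c * v i
  sum-delta {suc n} zero c v = trans
    (cong (c * v zero +_) (trans (sum-cong-≗ (λ j → *-zeroˡ (v (suc j)))) (sum-replicate-zero n)))
    (+-identityʳ _)
  sum-delta (suc i) c v = trans (cong₂ _+_ (*-zeroˡ (v zero)) (sum-delta i c (λ j → v (suc j))))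
    (+-identityˡ _)

  -- Finitely many positive numbers have a positive lower bound.
  positive-minorant : ∀ {n} (f : Fin n → ℚ) → (∀ i → 0ℚ < f i) →
    ∃[ η ] (0ℚ < η × (∀ i → η ≤ f i))
  positive-minorant {zero} f h = 1ℚ , positive⁻¹ 1ℚ , λ ()
  positive-minorant {suc n} f h =
    let η , 0<η , η≤ = positive-minorant (λ i → f (suc i)) (λ i → h (suc i)) in
    f zero ⊓ η , ⊓-pos (h zero) 0<η ,
    λ { zero → p⊓q≤p (f zero) η ; (suc i) → ≤-trans (p⊓q≤q (f zero) η) (η≤ i) }
    where
    ⊓-pos : ∀ {p q} → 0ℚ < p → 0ℚ < q → 0ℚ < p ⊓ q
    ⊓-pos {p} {q} 0<p 0<q with ⊓-sel p q
    ... | inj₁ eq = subst (0ℚ <_) (sym eq) 0<p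
    ... | inj₂ eq = subst (0ℚ <_) (sym eq) 0<q

  -- A positive lower bound for the quotients f i / g i, stated without division.
  quotient-minorant : ∀ {n} (f g : Fin n → ℚ) → (∀ i → 0ℚ < f i) → (∀ i → 0ℚ < g i) →
    ∃[ η ] (0ℚ < η × (∀ i → η * g i ≤ f i))
  quotient-minorant f g 0<f 0<g =
    let quotient = λ i → tolerance (g i) (f i) (0<g i) (0<f i)
        η , 0<η , η≤ = positive-minorant (λ i → proj₁ (quotient i))
                         (λ i → proj₁ (proj₂ (quotient i)))
    in η , 0<η , λ i → ≤-trans (*-monoʳ-≤ (<⇒≤ (0<g i)) (η≤ i))
         (≤-reflexive (trans (*-comm (proj₁ (quotient i)) (g i)) (proj₂ (proj₂ (quotient i)))))

  argmax : ∀ {n} (f : Fin (suc n) → ℚ) → ∃[ p ] (∀ i → f i ≤ f p)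
  argmax {zero} f = zero , λ { zero → ≤-refl }
  argmax {suc n} f with argmax (λ i → f (suc i))
  ... | p , h with ≤-total (f zero) (f (suc p))
  ... | inj₁ le = suc p , λ { zero → le ; (suc i) → h i }
  ... | inj₂ ge = zero , λ { zero → ≤-refl ; (suc i) → ≤-trans (h i) ge }

  -- A maximiser p of f, and a maximiser q of f away from p.
  argmax₂ : ∀ {n} (f : Fin (2 ℕ.+ n) → ℚ) →
    ∃[ p ] ∃[ q ] (q ≢ p × (∀ i → f i ≤ f p) × (∀ {i} → i ≢ p → f i ≤ f q))
  argmax₂ f =
    let p , f≤fp = argmax f
        k , f≤fk = argmax (λ j → f (punchIn p j))
    in p , punchIn p k , Fin.punchInᵢ≢i p k , f≤fp , λ {i} i≢p →
         subst (λ j → f j ≤ f (punchIn p k)) (Fin.punchIn-punchOut (≢-sym i≢p))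
           (f≤fk (punchOut (≢-sym i≢p)))

  -- Absolute values

  p≤∣p∣ : ∀ p → p ≤ ∣ p ∣
  p≤∣p∣ p with ≤-total 0ℚ p
  ... | inj₁ 0≤p = ≤-reflexive (sym (0≤p⇒∣p∣≡p 0≤p))
  ... | inj₂ p≤0 = ≤-trans p≤0 (0≤∣p∣ p)

  ∣p-q∣<ε⇒p<q+ε : ∀ {p q ε} → ∣ p - q ∣ < ε → p < q + ε
  ∣p-q∣<ε⇒p<q+ε {p} {q} h = subst (_< q + _) (sym (trans (p≡[p-q]+q p q) (+-comm (p - q) q)))
    (+-monoʳ-< q (≤-<-trans (p≤∣p∣ (p - q)) h))

  ∣p-q∣≡∣q-p∣ : ∀ p q → ∣ p - q ∣ ≡ ∣ q - p ∣
  ∣p-q∣≡∣q-p∣ p q = trans (sym (∣-p∣≡∣p∣ (p - q)))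
    (cong ∣_∣ (solve 2 (λ p q → :- (p :- q) := q :- p) refl p q))

  ∣p-q∣<ε⇒q<p+ε : ∀ {p q ε} → ∣ p - q ∣ < ε → q < p + ε
  ∣p-q∣<ε⇒q<p+ε {p} {q} h = ∣p-q∣<ε⇒p<q+ε (subst (_< _) (∣p-q∣≡∣q-p∣ p q) h)

  <+⇒-< : ∀ {p q ε} → p < q + ε → p - q < ε
  <+⇒-< {p} {q} {ε} h = subst (p - q <_) (solve 2 (λ q ε → q :+ ε :- q := ε) refl q ε)
    (+-monoˡ-< (- q) h)

  p<q+ε∧q<p+ε⇒∣p-q∣<ε : ∀ {p q ε} → p < q + ε → q < p + ε → ∣ p - q ∣ < ε
  p<q+ε∧q<p+ε⇒∣p-q∣<ε {p} {q} {ε} h k with ∣p∣≡p∨∣p∣≡-p (p - q)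
  ... | inj₁ eq = subst (_< ε) (sym eq) (<+⇒-< h)
  ... | inj₂ eq = subst (_< ε) (sym (trans eq (solve 2 (λ p q → :- (p :- q) := q :- p) refl p q))) (<+⇒-< k)

  -- The Archimedean property of ℚ

  -- The embedding of ℕ into ℚ, by recursion so that nat (suc n) unfolds to
  -- 1ℚ + nat n.
  nat : ℕ → ℚ
  nat zero = 0ℚ
  nat (suc n) = 1ℚ + nat n

  nat-nonneg : ∀ n → 0ℚ ≤ nat n
  nat-nonneg zero = ≤-refl
  nat-nonneg (suc n) = nonneg-+ (nonNegative⁻¹ 1ℚ) (nat-nonneg n)

  nat-mono : ∀ {m n} → m ℕ.≤ n → nat m ≤ nat n
  nat-mono {n = n} ℕ.z≤n = nat-nonneg n
  nat-mono (ℕ.s≤s h) = +-monoʳ-≤ 1ℚ (nat-mono h)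

  nat≡mkℚ : ∀ n → nat n ≡ mkℚ (ℤ.+ n) 0 (Coprimality.sym (Coprimality.1-coprimeTo n))
  nat≡mkℚ zero = refl
  nat≡mkℚ (suc n) = trans (cong (1ℚ +_) (nat≡mkℚ n)) (toℚᵘ-injective
    (ℚᵘ.≃-trans (toℚᵘ-homo-+ 1ℚ (mkℚ (ℤ.+ n) 0 (Coprimality.sym (Coprimality.1-coprimeTo n))))
      (ℚᵘ.*≡* (cong (ℤ._* ℤ.+ 1) (cong (ℤ.suc) (ℤ.*-identityʳ (ℤ.+ n)))))))

  archimedean : ∀ q → ∃[ n ] q < nat n
  archimedean (mkℚ (ℤ.+ m) d c) = suc m , ≤-<-trans
    (subst (mkℚ (ℤ.+ m) d c ≤_) (sym (nat≡mkℚ m)) (*≤* (ℤ.*-monoˡ-≤-nonNeg (ℤ.+ m) (ℤ.+≤+ (ℕ.s≤s ℕ.z≤n)))))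
    (<-by 1ℚ (positive⁻¹ 1ℚ) (+-comm (nat m) 1ℚ))
  archimedean (mkℚ -[1+ m ] d c) = 0 , negative⁻¹ (mkℚ -[1+ m ] d c)

  -- The number 1/(n+1), with its defining property.
  unit-fraction : ∀ n → ∃[ u ] (0ℚ < u × nat (suc n) * u ≡ 1ℚ)
  unit-fraction n = tolerance (nat (suc n)) 1ℚ (pos-+ (positive⁻¹ 1ℚ) (nat-nonneg n)) (positive⁻¹ 1ℚ)

  unit-fraction-small : ∀ ε → 0ℚ < ε → ∃[ N ] (∀ n → N ℕ.≤ n → proj₁ (unit-fraction n) < ε)
  unit-fraction-small ε 0<ε =
    let E , 0<E , εE≡1 = tolerance ε 1ℚ 0<ε (positive⁻¹ 1ℚ)
        N , E<N = archimedean E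
    in N , λ n N≤n →
      let u , 0<u , nu≡1 = unit-fraction n
          E<n+1 = <-≤-trans E<N (nat-mono (ℕ.m≤n⇒m≤1+n N≤n))
      in *-cancelˡ-< (<⇒≤ 0<E) (subst₂ _<_ refl
           (trans nu≡1 (trans (sym εE≡1) (*-comm ε E)))
           (subst₂ _<_ (*-comm u E) (*-comm u (nat (suc n))) (*-monoˡ-< 0<u E<n+1)))

  -- The order on Cauchy reals

  ≤ᴿ-trans : ∀ {x y z} → x ≤ᴿ y → y ≤ᴿ z → x ≤ᴿ z
  ≤ᴿ-trans {x} {y} {z} h k = mk≤ λ ε 0<ε →
    let δ , 0<δ , δ+δ≡ε = halve ε 0<ε
        M , hM = below h δ 0<δ
        N , kN = below k δ 0<δ
    in M ℕ.⊔ N , λ n p → <-trans (hM n (ℕ.m⊔n≤o⇒m≤o M N p))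
         (subst (seq y n + δ <_)
           (trans (+-assoc (seq z n) δ δ) (cong (seq z n +_) δ+δ≡ε))
           (+-monoˡ-< δ (kN n (ℕ.m⊔n≤o⇒n≤o M N p))))

  ≈ᴿ⇒≤ᴿ : ∀ {x y} → x ≈ᴿ y → x ≤ᴿ y
  ≈ᴿ⇒≤ᴿ h = mk≤ λ ε 0<ε → let N , hN = close h ε 0<ε in
    N , λ n p → ∣p-q∣<ε⇒p<q+ε (hN n p)

  ≈ᴿ⇒≥ᴿ : ∀ {x y} → x ≈ᴿ y → y ≤ᴿ x
  ≈ᴿ⇒≥ᴿ {x} {y} h = mk≤ λ ε 0<ε → let N , hN = close h ε 0<ε in
    N , λ n p → ∣p-q∣<ε⇒q<p+ε {seq x n} {seq y n} (hN n p)

  ≤ᴿ-antisym : ∀ {x y} → x ≤ᴿ y → y ≤ᴿ x → x ≈ᴿ y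
  ≤ᴿ-antisym h k = mk≈ λ ε 0<ε →
    let M , hM = below h ε 0<ε
        N , kN = below k ε 0<ε
    in M ℕ.⊔ N , λ n p → p<q+ε∧q<p+ε⇒∣p-q∣<ε
         (hM n (ℕ.m⊔n≤o⇒m≤o M N p)) (kN n (ℕ.m⊔n≤o⇒n≤o M N p))

  fromℚ-cancel-≤ : ∀ {p q} → fromℚ p ≤ᴿ fromℚ q → p ≤ q
  fromℚ-cancel-≤ {p} {q} h with p ≤? q
  ... | yes p≤q = p≤q
  ... | no p≰q =
    let N , hN = below h (p - q) (p<q⇒0<q-p (≰⇒> p≰q))
    in ⊥-elim (<-irrefl (solve 2 (λ p q → p := q :+ (p :- q)) refl p q) (hN N ℕ.≤-refl))

  ≈-pointwise : ∀ {x y} → (∀ n → seq x n ≡ seq y n) → x ≈ᴿ y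
  ≈-pointwise {x} {y} h = mk≈ λ ε 0<ε → 0 , λ n _ →
    subst (_< ε) (sym (cong ∣_∣ (trans (cong (_- seq y n) (h n)) (+-inverseʳ (seq y n))))) 0<ε

  -- x ≤ y as soon as rationals below y come arbitrarily close to upper bounds
  -- of x.
  ≤ᴿ-by-approximation : ∀ {x y} →
    (∀ δ → 0ℚ < δ → ∃[ k ] (fromℚ k ≤ᴿ y × x ≤ᴿ fromℚ (k + δ))) → x ≤ᴿ y
  ≤ᴿ-by-approximation {x} {y} h = mk≤ λ ε 0<ε →
    let δ , 0<δ , δ+δ≡ε = halve ε 0<ε
        γ , 0<γ , γ+γ≡δ = halve δ 0<δ
        k , k≤y , x≤k+δ = h δ 0<δ
        M , hM = below x≤k+δ γ 0<γ
        N , hN = below k≤y γ 0<γ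
    in M ℕ.⊔ N , λ n p → <-trans (hM n (ℕ.m⊔n≤o⇒m≤o M N p))
        (subst₂ _<_ (solve 3 (λ k δ γ → k :+ (δ :+ γ) := k :+ δ :+ γ) refl k δ γ)
           (trans (solve 3 (λ s δ γ → s :+ γ :+ (δ :+ γ) := s :+ (δ :+ (γ :+ γ))) refl (seq y n) δ γ)
             (cong (seq y n +_) (trans (cong (δ +_) γ+γ≡δ) δ+δ≡ε)))
           (+-monoˡ-< (δ + γ) (hN n (ℕ.m⊔n≤o⇒n≤o M N p))))

  -- The order is stable under double negation: a real that does not
  -- eventually exceed c by a fixed amount is at most c. The modulus of
  -- convergence of x reduces the question to a decidable comparison at one
  -- index, and this is what licenses the classical argument with eigenvectors
  -- below.
  ¬above⇒≤ᴿ : ∀ x c →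
    (∀ ε → 0ℚ < ε → ¬ (∃[ N ] (∀ n → N ℕ.≤ n → c + ε ≤ seq x n))) → x ≤ᴿ fromℚ c
  ¬above⇒≤ᴿ x c h = mk≤ λ ε 0<ε →
    let δ , 0<δ , δ+δ≡ε = halve ε 0<ε
        γ , 0<γ , γ+γ≡δ = halve δ 0<δ
        N , hN = cauchy x γ 0<γ
        γ<δ = <-by γ 0<γ γ+γ≡δ
    in N , λ n N≤n → decide ε δ γ N n δ+δ≡ε γ+γ≡δ 0<γ γ<δ hN N≤n
    where
    decide : ∀ ε δ γ N n → δ + δ ≡ ε → γ + γ ≡ δ → 0ℚ < γ → γ < δ →
      (∀ m n → N ℕ.≤ m → N ℕ.≤ n → ∣ seq x m - seq x n ∣ < γ) → N ℕ.≤ n →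
      seq x n < c + ε
    decide ε δ γ N n δ+δ≡ε γ+γ≡δ 0<γ γ<δ hN N≤n with seq x N <? c + δ
    ... | yes below = <-trans (∣p-q∣<ε⇒p<q+ε (hN n N N≤n ℕ.≤-refl))
            (subst (seq x N + γ <_) (trans (+-assoc c δ δ) (cong (_+_ c) δ+δ≡ε)) (+-mono-< below γ<δ))
    ... | no above = ⊥-elim (h γ 0<γ (N , λ m N≤m → <⇒≤ (+-cancelʳ-< γ (≤-<-trans
            (subst (_≤ seq x N) (trans (cong (_+_ c) (sym γ+γ≡δ)) (sym (+-assoc c γ γ))) (≮⇒≥ above))
            (∣p-q∣<ε⇒q<p+ε {seq x m} {seq x N} (hN m N N≤m ℕ.≤-refl))))))
      where
      +-cancelʳ-< : ∀ r {p q} → p + r < q + r → p < q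
      +-cancelʳ-< r {p} {q} lt = subst₂ _<_ (cancel p) (cancel q) (+-monoˡ-< (- r) lt)
        where
        cancel : ∀ p → p + r - r ≡ p
        cancel p = solve 2 (λ p r → p :+ r :- r := p) refl p r

  -- Square roots of positive rationals

  -- The last multiple k of δ with k² < q; it lies within δ below √q.
  sqrt-bracket : ∀ {q δ} → 0ℚ < q → 0ℚ < δ →
    ∃[ k ] (0ℚ ≤ k × k * k < q × q ≤ (k + δ) * (k + δ))
  sqrt-bracket {q} {δ} 0<q 0<δ =
    let 0<q+1 = pos-+ 0<q (nonNegative⁻¹ 1ℚ)
        E , 0<E , δE≡q+1 = tolerance δ (q + 1ℚ) 0<δ 0<q+1
        K , E<K = archimedean E
        q+1≤Kδ = subst₂ _≤_ δE≡q+1 (*-comm δ (nat K)) (*-monoˡ-≤ (<⇒≤ 0<δ) (<⇒≤ E<K))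
        q≤[q+1]² = ≤-by (q * q + q + 1ℚ)
          (nonneg-+ (nonneg-+ (0≤p*p q) (<⇒≤ 0<q)) (nonNegative⁻¹ 1ℚ))
          (solve 1 (λ q → q :+ (q :* q :+ q :+ con 1ℚ) := (q :+ con 1ℚ) :* (q :+ con 1ℚ)) refl q)
    in search K (≤-trans q≤[q+1]² (*-mono-≤ (<⇒≤ 0<q+1)
         (nonneg-* (nat-nonneg K) (<⇒≤ 0<δ)) q+1≤Kδ q+1≤Kδ))
    where
    -- Search downwards from a multiple K δ whose square is at least q.
    search : ∀ K → q ≤ (nat K * δ) * (nat K * δ) →
      ∃[ k ] (0ℚ ≤ k × k * k < q × q ≤ (k + δ) * (k + δ))
    search zero h = ⊥-elim (<-irrefl refl (<-≤-trans 0<q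
      (subst (q ≤_) (solve 1 (λ δ → con 0ℚ :* δ :* (con 0ℚ :* δ) := con 0ℚ) refl δ) h)))
    search (suc K) h with nat K * δ * (nat K * δ) <? q
    ... | yes lt = nat K * δ , nonneg-* (nat-nonneg K) (<⇒≤ 0<δ) , lt ,
      subst (λ t → q ≤ t * t) (solve 2 (λ K δ → (con 1ℚ :+ K) :* δ := K :* δ :+ δ) refl (nat K) δ) h
    ... | no ge = search K (≮⇒≥ ge)

  -- Uniform continuity of squaring on the interval from 0 to C, upwards.
  -- Any δ with δ ≤ 1 and (1 + 2C) δ ≤ e will do.
  square-increment : ∀ {C e} → 0ℚ ≤ C → 0ℚ < e →
    ∃[ δ ] (0ℚ < δ × (∀ {c} → 0ℚ ≤ c → c ≤ C → (c + δ) * (c + δ) ≤ c * c + e))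
  square-increment {C} {e} 0≤C 0<e =
    let D = 1ℚ + (C + C)
        0<D = pos-+ (positive⁻¹ 1ℚ) (nonneg-+ 0≤C 0≤C)
        γ , 0<γ , Dγ≡e = tolerance D e 0<D 0<e
        η , 0<η , η≤ = positive-minorant {2} (λ { zero → 1ℚ ; (suc _) → γ })
          (λ { zero → positive⁻¹ 1ℚ ; (suc _) → 0<γ })
    in η , 0<η , λ {c} 0≤c c≤C →
      ≤-trans (≤-reflexive (solve 2 (λ c η → (c :+ η) :* (c :+ η) := c :* c :+ (η :+ (c :+ c)) :* η) refl c η))
        (+-monoʳ-≤ (c * c) (≤-trans
          (*-mono-≤ (nonneg-+ (<⇒≤ 0<η) (nonneg-+ 0≤c 0≤c)) (<⇒≤ 0<γ)
            (+-mono-≤ (η≤ zero) (+-mono-≤ c≤C c≤C)) (η≤ (suc zero)))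
          (≤-reflexive Dγ≡e)))

  ≤-sq-bound : ∀ {q k} → 0ℚ < q → k * k < q → k ≤ q + 1ℚ
  ≤-sq-bound {q} {k} 0<q k²<q = <⇒≤ (*-cancel-sq-< (nonneg-+ (<⇒≤ 0<q) (nonNegative⁻¹ 1ℚ))
    (<-trans k²<q (<-by (q * q + (1ℚ + q))
      (subst (0ℚ <_) (+-comm (1ℚ + q) (q * q)) (pos-+ (pos-+ (positive⁻¹ 1ℚ) (<⇒≤ 0<q)) (0≤p*p q)))
      (solve 1 (λ q → q :+ (q :* q :+ (con 1ℚ :+ q)) := (q :+ con 1ℚ) :* (q :+ con 1ℚ)) refl q))))

  -- Strict lower approximations to √q, with the error measured on squares.
  sqrt-approximation : ∀ {q e} → 0ℚ < q → 0ℚ < e →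
    ∃[ k ] (0ℚ ≤ k × k * k < q × q ≤ k * k + e)
  sqrt-approximation {q} 0<q 0<e =
    let δ , 0<δ , inc = square-increment (nonneg-+ (<⇒≤ 0<q) (nonNegative⁻¹ 1ℚ)) 0<e
        k , 0≤k , k²<q , q≤ = sqrt-bracket 0<q 0<δ
    in k , 0≤k , k²<q , ≤-trans q≤ (inc 0≤k (≤-sq-bound 0<q k²<q))

  -- The sequence whose n-th term is within 1/(n+1) below √q.
  sqrt-exists : ∀ {q} → 0ℚ < q → ∃[ s ] IsSqrt (fromℚ q) s
  sqrt-exists {q} 0<q = mkℝ f f-cauchy , nonneg , mk≈ square
    where
    u : ℕ → ℚ
    u n = proj₁ (unit-fraction n)
    bracket : ∀ n → ∃[ k ] (0ℚ ≤ k × k * k < q × q ≤ (k + u n) * (k + u n))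
    bracket n = sqrt-bracket 0<q (proj₁ (proj₂ (unit-fraction n)))
    f : ℕ → ℚ
    f n = proj₁ (bracket n)
    f-nonneg : ∀ n → 0ℚ ≤ f n
    f-nonneg n = proj₁ (proj₂ (bracket n))
    f²<q : ∀ n → f n * f n < q
    f²<q n = proj₁ (proj₂ (proj₂ (bracket n)))
    q≤[f+u]² : ∀ n → q ≤ (f n + u n) * (f n + u n)
    q≤[f+u]² n = proj₂ (proj₂ (proj₂ (bracket n)))
    f<f+u : ∀ m n → f m < f n + u n
    f<f+u m n = *-cancel-sq-< (nonneg-+ (f-nonneg n) (<⇒≤ (proj₁ (proj₂ (unit-fraction n)))))
      (<-≤-trans (f²<q m) (q≤[f+u]² n))
    f-cauchy : IsCauchy f
    f-cauchy ε 0<ε =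
      let N , small = unit-fraction-small ε 0<ε
      in N , λ m n N≤m N≤n → p<q+ε∧q<p+ε⇒∣p-q∣<ε
           (<-trans (f<f+u m n) (+-monoʳ-< (f n) (small n N≤n)))
           (<-trans (f<f+u n m) (+-monoʳ-< (f m) (small m N≤m)))
    nonneg : 0ᴿ ≤ᴿ mkℝ f f-cauchy
    nonneg = mk≤ λ ε 0<ε → 0 , λ n _ →
      subst (0ℚ <_) (+-comm ε (f n)) (pos-+ 0<ε (f-nonneg n))
    square : ∀ ε → 0ℚ < ε → ∃[ N ] (∀ n → N ℕ.≤ n → ∣ f n * f n - q ∣ < ε)
    square ε 0<ε =
      let e , 0<e , e+e≡ε = halve ε 0<ε
          δ , 0<δ , inc = square-increment (nonneg-+ (<⇒≤ 0<q) (nonNegative⁻¹ 1ℚ)) 0<e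
          N , small = unit-fraction-small δ 0<δ
      in N , λ n N≤n →
        let f+u≤f+δ = +-monoʳ-≤ (f n) (<⇒≤ (small n N≤n))
            0≤f+u = nonneg-+ (f-nonneg n) (<⇒≤ (proj₁ (proj₂ (unit-fraction n))))
        in p<q+ε∧q<p+ε⇒∣p-q∣<ε
          (<-trans (f²<q n) (<-by ε 0<ε refl))
          (≤-<-trans (≤-trans (q≤[f+u]² n)
              (≤-trans (*-mono-≤ 0≤f+u (≤-trans 0≤f+u f+u≤f+δ) f+u≤f+δ f+u≤f+δ)
                (inc (f-nonneg n) (≤-sq-bound 0<q (f²<q n)))))
            (+-monoʳ-< (f n * f n) (<-by e 0<e e+e≡ε)))

  -- If t is close to s and t + ε ≤ c, then c - t ≥ ε and, as t is almost
  -- nonnegative, c + t ≥ ε/2; so t² ≤ c² - ε²/2, which is too far below q.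
  ≤-sqrt : ∀ {q s c} → IsSqrt (fromℚ q) s → 0ℚ ≤ c → c * c ≤ q → fromℚ c ≤ᴿ s
  ≤-sqrt {q} {s} {c} (0≤s , s²≈q) 0≤c c²≤q = mk≤ λ ε 0<ε →
    let η , 0<η , η+η≡ε = halve ε 0<ε
        δ , 0<δ , δ+δ≡η = halve η 0<η
        M , hM = below 0≤s δ 0<δ
        N , hN = close s²≈q (ε * η) (pos-* 0<ε 0<η)
    in M ℕ.⊔ N , λ n p → bound (seq s n) ε η δ 0<ε 0<η η+η≡ε δ+δ≡η
         (hM n (ℕ.m⊔n≤o⇒m≤o M N p)) (hN n (ℕ.m⊔n≤o⇒n≤o M N p))
    where
    bound : ∀ t ε η δ → 0ℚ < ε → 0ℚ < η → η + η ≡ ε → δ + δ ≡ η →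
      0ℚ < t + δ → ∣ t * t - q ∣ < ε * η → c < t + ε
    bound t ε η δ 0<ε 0<η η+η≡ε δ+δ≡η 0<t+δ h with c <? t + ε
    ... | yes lt = lt
    ... | no ge = ⊥-elim (<-irrefl refl (<-≤-trans (∣p-q∣<ε⇒q<p+ε {t * t} {q} h)
            (≤-trans t²+εη≤c² c²≤q)))
      where
      t+ε≤c : t + ε ≤ c
      t+ε≤c = ≮⇒≥ ge
      ε≤c-t : ε ≤ c - t
      ε≤c-t = subst (_≤ c - t) (solve 2 (λ t ε → t :+ ε :- t := ε) refl t ε) (+-monoˡ-≤ (- t) t+ε≤c)
      η≤c+t : η ≤ c + t
      η≤c+t = ≤-trans (≤-by (t + δ + (t + δ)) (nonneg-+ (<⇒≤ 0<t+δ) (<⇒≤ 0<t+δ)) (begin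
          η + (t + δ + (t + δ))  ≡⟨ solve 3 (λ η t δ → η :+ (t :+ δ :+ (t :+ δ)) := t :+ (η :+ (δ :+ δ)) :+ t) refl η t δ ⟩
          t + (η + (δ + δ)) + t  ≡⟨ cong (λ e → t + e + t) (trans (cong (_+_ η) δ+δ≡η) η+η≡ε) ⟩
          t + ε + t              ∎))
        (+-monoˡ-≤ t t+ε≤c)
        where open ≡-Reasoning
      t²+εη≤c² : t * t + ε * η ≤ c * c
      t²+εη≤c² = ≤-trans
        (+-monoʳ-≤ (t * t) (*-mono-≤ (<⇒≤ 0<ε) (≤-trans (<⇒≤ 0<η) η≤c+t) ε≤c-t η≤c+t))
        (≤-reflexive (solve 2 (λ c t → t :* t :+ (c :- t) :* (c :+ t) := c :* c) refl c t))

  sqrt-≤ : ∀ {q s c} → IsSqrt (fromℚ q) s → 0ℚ ≤ c → q ≤ c * c → s ≤ᴿ fromℚ c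
  sqrt-≤ {q} {s} {c} (_ , s²≈q) 0≤c q≤c² = mk≤ λ ε 0<ε →
    let N , hN = close s²≈q (ε * ε) (pos-* 0<ε 0<ε)
    in N , λ n p → *-cancel-sq-< (nonneg-+ 0≤c (<⇒≤ 0<ε))
         (<-≤-trans (∣p-q∣<ε⇒p<q+ε (hN n p)) (≤-trans (+-monoˡ-≤ (ε * ε) q≤c²)
           (≤-by (c * ε + c * ε) (nonneg-+ (nonneg-* 0≤c (<⇒≤ 0<ε)) (nonneg-* 0≤c (<⇒≤ 0<ε)))
             (solve 2 (λ c ε → c :* c :+ ε :* ε :+ (c :* ε :+ c :* ε) := (c :+ ε) :* (c :+ ε)) refl c ε))))

  -- A rational c just below √(ab). The distance from a to √(ab) is at least
  -- the distance from a to (a + b)/2, which is why the error in c² can be made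
  -- small in proportion to a - c.
  below-geometric-mean : ∀ {a b η} → 0ℚ < b → b < a → 0ℚ < η →
    ∃[ c ] (0ℚ < c × c ≤ a × c * c < a * b × a * b ≤ c * c + η * (a - c))
  below-geometric-mean {a} {b} {η} 0<b b<a 0<η =
    let e , 0<e , e≤ = positive-minorant bounds bounds-pos
        c , 0≤c , c²<ab , ab≤c²+e = sqrt-approximation (pos-* 0<a 0<b) 0<e
        d≤a-c = half-gap 0≤c c²<ab
    in c , <-≤-trans 0<b (lower 0≤c ab≤c²+e (e≤ (suc zero)))
     , 0≤q-p⇒p≤q (≤-trans (<⇒≤ 0<d) d≤a-c) , c²<ab
     , ≤-trans ab≤c²+e (+-monoʳ-≤ (c * c)
         (≤-trans (e≤ zero) (*-monoˡ-≤ (<⇒≤ 0<η) d≤a-c)))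
    where
    0<a : 0ℚ < a
    0<a = <-trans 0<b b<a
    d : ℚ
    d = ½ * (a - b)
    0<d : 0ℚ < d
    0<d = pos-* (positive⁻¹ ½) (p<q⇒0<q-p b<a)
    -- The first bound makes the error small in proportion to a - c; the second
    -- keeps c at least b, hence positive.
    bounds : Fin 2 → ℚ
    bounds zero = η * d
    bounds (suc _) = b * (a - b)
    bounds-pos : ∀ i → 0ℚ < bounds i
    bounds-pos zero = pos-* 0<η 0<d
    bounds-pos (suc _) = pos-* 0<b (p<q⇒0<q-p b<a)
    0≤q-p⇒p≤q : ∀ {p q} → 0ℚ ≤ q - p → p ≤ q
    0≤q-p⇒p≤q {p} {q} h = ≤-by (q - p) h (solve 2 (λ p q → p :+ (q :- p) := q) refl p q)
    lower : ∀ {c e} → 0ℚ ≤ c → a * b ≤ c * c + e → e ≤ b * (a - b) → b ≤ c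
    lower {c} {e} 0≤c ab≤c²+e e≤ = *-cancel-sq-≤ 0≤c (subst₂ _≤_
      (solve 2 (λ a b → a :* b :+ :- (b :* (a :- b)) := b :* b) refl a b)
      (solve 2 (λ c e → c :+ e :+ :- e := c) refl (c * c) e)
      (+-mono-≤ ab≤c²+e (neg-antimono-≤ e≤)))
    half-gap : ∀ {c} → 0ℚ ≤ c → c * c < a * b → d ≤ a - c
    half-gap {c} 0≤c c²<ab = subst (_≤ a - c)
      (solve 2 (λ a b → a :- con ½ :* (a :+ b) := con ½ :* (a :- b)) refl a b)
      (+-monoʳ-≤ a (neg-antimono-≤ c≤mean))
      where
      c≤mean : c ≤ ½ * (a + b)
      c≤mean = *-cancel-sq-≤ (nonneg-* (nonNegative⁻¹ ½) (<⇒≤ (pos-+ 0<a (<⇒≤ 0<b))))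
        (≤-trans (<⇒≤ c²<ab) (≤-by (d * d) (0≤p*p d)
          (solve 2 (λ a b → a :* b :+ con ½ :* (a :- b) :* (con ½ :* (a :- b)) :=
            con ½ :* (a :+ b) :* (con ½ :* (a :+ b))) refl a b)))

  -- Eigenvalues and positive test vectors

  eventually-all : ∀ {n} (P : Fin n → ℕ → Set) →
    (∀ i → ∃[ N ] (∀ m → N ℕ.≤ m → P i m)) →
    ∃[ N ] (∀ m → N ℕ.≤ m → ∀ i → P i m)
  eventually-all {zero} P h = 0 , λ _ _ ()
  eventually-all {suc n} P h =
    let M , hM = h zero
        N , hN = eventually-all (λ i → P (suc i)) (λ i → h (suc i))
    in M ℕ.⊔ N , λ m p →
      λ { zero → hM m (ℕ.m⊔n≤o⇒m≤o M N p) ; (suc i) → hN m (ℕ.m⊔n≤o⇒n≤o M N p) i }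

  seq-sumᴿ : ∀ {k} (f : Fin k → ℝ) n → seq (sumᴿ f) n ≡ sum (λ j → seq (f j) n)
  seq-sumᴿ {zero} f n = refl
  seq-sumᴿ {suc k} f n = cong (_+_ (seq (f zero) n)) (seq-sumᴿ (λ j → f (suc j)) n)

  -- The product of a matrix and a column vector.
  infixl 7 _·_
  _·_ : ∀ {n} → Matrix n → (Fin n → ℚ) → Fin n → ℚ
  (A · v) i = sum (λ j → A i j * v j)

  ·-nonneg : ∀ {n} {A : Matrix n} {v : Fin n → ℚ} → (∀ i j → 0ℚ ≤ A i j) →
    (∀ i → 0ℚ ≤ v i) → ∀ i → 0ℚ ≤ (A · v) i
  ·-nonneg 0≤A 0≤v i = sum-nonneg (λ j → nonneg-* (0≤A i j) (0≤v j))

  ·-linear : ∀ {n} (A : Matrix n) a b (u v : Fin n → ℚ) i →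
    (A · (λ j → a * u j + b * v j)) i ≡ a * (A · u) i + b * (A · v) i
  ·-linear A a b u v i = trans
    (sum-cong-≗ (λ j → solve 5 (λ A a b u v → A :* (a :* u :+ b :* v) :=
       a :* (A :* u) :+ b :* (A :* v)) refl (A i j) a b (u j) (v j)))
    (sum-linear a b (λ j → A i j * u j) (λ j → A i j * v j))

  off-diagonal-pos⇒nonneg : ∀ {n} {A : Matrix n} → (∀ i → A i i ≡ 0ℚ) →
    (∀ {i j} → i ≢ j → 0ℚ < A i j) → ∀ i j → 0ℚ ≤ A i j
  off-diagonal-pos⇒nonneg A-diagonal A-positive i j with i Fin.≟ j
  ... | yes refl = ≤-reflexive (sym (A-diagonal i))
  ... | no i≢j = <⇒≤ (A-positive i≢j)

  row-pos : ∀ {n} {A : Matrix (2 ℕ.+ n)} → (∀ i j → 0ℚ ≤ A i j) →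
    (∀ {i j} → i ≢ j → 0ℚ < A i j) → ∀ {v} → (∀ i → 0ℚ < v i) → ∀ i → 0ℚ < (A · v) i
  row-pos 0≤A A-positive 0<v i = sum-pos (λ j → nonneg-* (0≤A i j) (<⇒≤ (0<v j))) (punchIn i zero)
    (pos-* (A-positive (≢-sym (Fin.punchInᵢ≢i i zero))) (0<v (punchIn i zero)))

  -- The quantitative core of the Collatz-Wielandt bound. If v is an
  -- approximate eigenvector for λ′ with residual at most δ, then
  -- λ′ ∣vᵢ∣ ≤ Σⱼ Aᵢⱼ ∣vⱼ∣ + δ for all i; the combination of these inequalities
  -- with weights zᵢ gives λ′ W ≤ c W + δ Σ z, where W = Σ zᵢ ∣vᵢ∣.
  weighted-estimate : ∀ {n} {A : Matrix n} {z : Fin n → ℚ} {c} →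
    (∀ i j → 0ℚ ≤ A i j) → (∀ i → 0ℚ ≤ z i) →
    (∀ j → sum (λ i → z i * A i j) ≤ c * z j) →
    ∀ {v : Fin n → ℚ} {λ′ ε δ} →
    (∀ i → ∣ sum (λ j → A i j * v j) - λ′ * v i ∣ ≤ δ) → c + ε ≤ λ′ →
    ε * sum (λ i → z i * ∣ v i ∣) ≤ δ * sum z
  weighted-estimate {n} {A} {z} {c} 0≤A 0≤z zA≤cz {v} {λ′} {ε} {δ} residual c+ε≤λ′ =
    subst₂ _≤_ (solve 3 (λ c ε W → (c :+ ε) :* W :- c :* W := ε :* W) refl c ε W)
      (solve 2 (λ a b → a :+ b :- a := b) refl (c * W) (δ * sum z))
      (+-monoˡ-≤ (- (c * W)) (≤-trans (*-monoʳ-≤ 0≤W c+ε≤λ′) upper))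
    where
    W : ℚ
    W = sum (λ i → z i * ∣ v i ∣)
    0≤W : 0ℚ ≤ W
    0≤W = sum-nonneg (λ i → nonneg-* (0≤z i) (0≤∣p∣ (v i)))
    S : Fin n → ℚ
    S i = sum (λ j → A i j * v j)
    row : ∀ i → λ′ * ∣ v i ∣ ≤ sum (λ j → A i j * ∣ v j ∣) + δ
    row i = begin
      λ′ * ∣ v i ∣                    ≤⟨ *-monoʳ-≤ (0≤∣p∣ (v i)) (p≤∣p∣ λ′) ⟩
      ∣ λ′ ∣ * ∣ v i ∣                ≡⟨ ∣p*q∣≡∣p∣*∣q∣ λ′ (v i) ⟨
      ∣ λ′ * v i ∣                    ≡⟨ cong ∣_∣ (solve 2 (λ s t → t := s :- (s :- t)) refl (S i) (λ′ * v i)) ⟩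
      ∣ S i - (S i - λ′ * v i) ∣      ≤⟨ ∣p-q∣≤∣p∣+∣q∣ (S i) (S i - λ′ * v i) ⟩
      ∣ S i ∣ + ∣ S i - λ′ * v i ∣    ≤⟨ +-mono-≤ (∣sum∣≤sum∣∣ (λ j → A i j * v j)) (residual i) ⟩
      sum (λ j → ∣ A i j * v j ∣) + δ
        ≡⟨ cong (_+ δ) (sum-cong-≗ (λ j → trans (∣p*q∣≡∣p∣*∣q∣ (A i j) (v j))
             (cong (_* ∣ v j ∣) (0≤p⇒∣p∣≡p (0≤A i j))))) ⟩
      sum (λ j → A i j * ∣ v j ∣) + δ ∎
      where open ≤-Reasoning
    upper : λ′ * W ≤ c * W + δ * sum z
    upper = begin
      λ′ * W
        ≡⟨ *-distribˡ-sum λ′ (λ i → z i * ∣ v i ∣) ⟩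
      sum (λ i → λ′ * (z i * ∣ v i ∣))
        ≡⟨ sum-cong-≗ (λ i → solve 3 (λ l z v → l :* (z :* v) := z :* (l :* v)) refl λ′ (z i) ∣ v i ∣) ⟩
      sum (λ i → z i * (λ′ * ∣ v i ∣))
        ≤⟨ sum-mono-≤ (λ i → *-monoˡ-≤ (0≤z i) (row i)) ⟩
      sum (λ i → z i * (sum (λ j → A i j * ∣ v j ∣) + δ))
        ≡⟨ sum-cong-≗ (λ i → trans (*-distribˡ-+ (z i) _ δ)
             (cong₂ _+_ (trans (*-distribˡ-sum (z i) (λ j → A i j * ∣ v j ∣))
                          (sum-cong-≗ (λ j → sym (*-assoc (z i) (A i j) ∣ v j ∣))))
               (*-comm (z i) δ))) ⟩
      sum (λ i → sum (λ j → z i * A i j * ∣ v j ∣) + δ * z i)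
        ≡⟨ ∑-distrib-+ (λ i → sum (λ j → z i * A i j * ∣ v j ∣)) (λ i → δ * z i) ⟩
      sum (λ i → sum (λ j → z i * A i j * ∣ v j ∣)) + sum (λ i → δ * z i)
        ≡⟨ cong₂ _+_ (∑-comm (λ i j → z i * A i j * ∣ v j ∣)) (sym (*-distribˡ-sum δ z)) ⟩
      sum (λ j → sum (λ i → z i * A i j * ∣ v j ∣)) + δ * sum z
        ≡⟨ cong (_+ δ * sum z) (sum-cong-≗ (λ j → sym (*-distribʳ-sum ∣ v j ∣ (λ i → z i * A i j)))) ⟩
      sum (λ j → sum (λ i → z i * A i j) * ∣ v j ∣) + δ * sum z
        ≤⟨ +-monoˡ-≤ (δ * sum z) (sum-mono-≤ (λ j → *-monoʳ-≤ (0≤∣p∣ (v j)) (zA≤cz j))) ⟩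
      sum (λ j → c * z j * ∣ v j ∣) + δ * sum z
        ≡⟨ cong (_+ δ * sum z) (trans (sum-cong-≗ (λ j → *-assoc c (z j) ∣ v j ∣))
             (sym (*-distribˡ-sum c (λ j → z j * ∣ v j ∣)))) ⟩
      c * W + δ * sum z ∎
      where open ≤-Reasoning

  -- A positive left vector z with zA ≤ cz bounds every eigenvalue by c.
  -- Otherwise the weighted estimate, applied to the terms of the Cauchy
  -- sequences of an eigenvector, would make all its entries vanish.
  collatz-wielandt : ∀ {n} {A : Matrix n} {z : Fin n → ℚ} {c} →
    (∀ i j → 0ℚ ≤ A i j) → (∀ i → 0ℚ < z i) →
    (∀ j → sum (λ i → z i * A i j) ≤ c * z j) →
    ∀ {μ} → IsEigenvalue A μ → μ ≤ᴿ fromℚ c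
  collatz-wielandt {n} {A} {z} {c} 0≤A 0<z zA≤cz {μ} (x , x≉0 , Ax≈μx) =
    ¬above⇒≤ᴿ μ c λ ε 0<ε above → x≉0 λ i → mk≈ (vanish ε 0<ε above i)
    where
    vanish : ∀ ε → 0ℚ < ε → ∃[ N ] (∀ m → N ℕ.≤ m → c + ε ≤ seq μ m) → ∀ k θ → 0ℚ < θ →
      ∃[ N ] (∀ m → N ℕ.≤ m → ∣ seq (x k) m - 0ℚ ∣ < θ)
    -- The residual δ is chosen with δ Σ z = ε z k θ/2, so that the estimate
    -- gives ∣ x k ∣ ≤ θ/2.
    vanish ε 0<ε (M , above) k θ 0<θ =
      let η , 0<η , η+η≡θ = halve θ 0<θ
          0≤z = λ i → <⇒≤ (0<z i)
          δ , 0<δ , Zδ≡ = tolerance (sum z) (ε * (z k * η)) (sum-pos 0≤z k (0<z k))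
                            (pos-* 0<ε (pos-* (0<z k) 0<η))
          N , hN = eventually-all
            (λ i m → ∣ seq (sumᴿ (λ j → fromℚ (A i j) *ᴿ x j)) m - seq μ m * seq (x i) m ∣ < δ)
            (λ i → close (Ax≈μx i) δ 0<δ)
      in M ℕ.⊔ N , λ m p →
        let v = λ i → seq (x i) m
            estimate = weighted-estimate {c = c} 0≤A 0≤z zA≤cz {v} {seq μ m} {ε} {δ}
              (λ i → subst (λ s → ∣ s - seq μ m * v i ∣ ≤ δ)
                (seq-sumᴿ (λ j → fromℚ (A i j) *ᴿ x j) m)
                (<⇒≤ (hN m (ℕ.m⊔n≤o⇒n≤o M N p) i)))
              (above m (ℕ.m⊔n≤o⇒m≤o M N p))
            term = term≤sum (λ i → nonneg-* (0≤z i) (0≤∣p∣ (v i))) k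
            ∣v∣≤η = *-cancelˡ-≤ (0<z k) (*-cancelˡ-≤ 0<ε
              (≤-trans (*-monoˡ-≤ (<⇒≤ 0<ε) term)
                (≤-trans estimate (≤-reflexive (trans (*-comm δ (sum z)) Zδ≡)))))
        in subst (λ t → ∣ t ∣ < θ) (sym (+-identityʳ (v k)))
             (≤-<-trans ∣v∣≤η (<-by η 0<η η+η≡θ))

  rational-eigenvalue : ∀ {n} {A : Matrix n} {v : Fin n → ℚ} {k} (i : Fin n) → v i ≢ 0ℚ →
    (∀ i → sum (λ j → A i j * v j) ≡ k * v i) → IsEigenvalue A (fromℚ k)
  rational-eigenvalue {A = A} {v} {k} i vi≢0 Av≡kv =
    (λ j → fromℚ (v j)) , nonzero , λ i → ≈-pointwise (λ n →
      trans (seq-sumᴿ (λ j → fromℚ (A i j) *ᴿ fromℚ (v j)) n) (Av≡kv i))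
    where
    nonzero : ¬ (∀ j → fromℚ (v j) ≈ᴿ 0ᴿ)
    nonzero h = vi≢0 (≤-antisym (fromℚ-cancel-≤ (≈ᴿ⇒≤ᴿ (h i))) (fromℚ-cancel-≤ (≈ᴿ⇒≥ᴿ (h i))))

  -- On at least three points, two points always leave a third one.
  third : ∀ {n} (i p : Fin (3 ℕ.+ n)) → ∃[ k ] (k ≢ i × k ≢ p)
  third zero zero = suc zero , (λ ()) , (λ ())
  third zero (suc zero) = suc (suc zero) , (λ ()) , (λ ())
  third zero (suc (suc _)) = suc zero , (λ ()) , (λ ())
  third (suc zero) zero = suc (suc zero) , (λ ()) , (λ ())
  third (suc (suc _)) zero = suc zero , (λ ()) , (λ ())
  third (suc _) (suc _) = zero , (λ ()) , (λ ())

  -- Eigenvalue bounds from weighted row sums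

  -- A symmetric matrix A with zero diagonal and positive entries elsewhere,
  -- and a positive vector r whose row quotients (A · r) i / r i are ρ i.
  module Spectrum {n} (A : Matrix n)
    (A-sym : ∀ i j → A i j ≡ A j i)
    (A-diagonal : ∀ i → A i i ≡ 0ℚ)
    (A-positive : ∀ {i j} → i ≢ j → 0ℚ < A i j)
    (r : Fin n → ℚ) (0<r : ∀ i → 0ℚ < r i)
    (ρ : Fin n → ℚ) (0<ρ : ∀ i → 0ℚ < ρ i)
    (Ar≡ρr : ∀ i → (A · r) i ≡ ρ i * r i)
    where

    A-nonneg : ∀ i j → 0ℚ ≤ A i j
    A-nonneg = off-diagonal-pos⇒nonneg A-diagonal A-positive

    eigenvalue-≤ : ∀ {z c} → (∀ i → 0ℚ < z i) → (∀ i → (A · z) i ≤ c * z i) →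
      ∀ {μ} → IsEigenvalue A μ → μ ≤ᴿ fromℚ c
    eigenvalue-≤ {z} 0<z Az≤cz = collatz-wielandt A-nonneg 0<z λ j →
      subst (_≤ _) (sum-cong-≗ (λ i → trans (*-comm (A j i) (z i)) (cong (z i *_) (A-sym j i))))
        (Az≤cz j)

    -- The vector r with entry p multiplied by α and all others by β.
    rescale : Fin n → ℚ → ℚ → Fin n → ℚ
    rescale p α β j = (if does (j Fin.≟ p) then α else β) * r j

    rescale-off : ∀ {p j} α β → j ≢ p → rescale p α β j ≡ β * r j
    rescale-off {p} {j} α β j≢p =
      cong (λ b → (if b then α else β) * r j) (dec-false (j Fin.≟ p) j≢p)

    -- Case distinction on the entries of a rescaled vector.
    rescale-elim : (P : Fin n → ℚ → Set) → ∀ {p α β} → P p (α * r p) →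
      (∀ {j} → j ≢ p → P j (β * r j)) → ∀ j → P j (rescale p α β j)
    rescale-elim P {p} {α} {β} at off j with j Fin.≟ p
    ... | yes refl = at
    ... | no j≢p = off j≢p

    rescale-pos : ∀ {p α β} → 0ℚ < α → 0ℚ < β → ∀ j → 0ℚ < rescale p α β j
    rescale-pos {p} 0<α 0<β = rescale-elim (λ _ t → 0ℚ < t)
      (pos-* 0<α (0<r p)) (λ {j} _ → pos-* 0<β (0<r j))

    rescale-row : ∀ p α β → (A · rescale p α β) p ≡ β * (ρ p * r p)
    rescale-row p α β = begin
      sum (λ j → A p j * rescale p α β j)
        ≡⟨ sum-cong-≗ (rescale-elim (λ j t → A p j * t ≡ β * (A p j * r j)) at
             (λ {j} _ → solve 3 (λ a b r → a :* (b :* r) := b :* (a :* r)) refl (A p j) β (r j))) ⟩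
      sum (λ j → β * (A p j * r j))
        ≡⟨ *-distribˡ-sum β (λ j → A p j * r j) ⟨
      β * (A · r) p
        ≡⟨ cong (β *_) (Ar≡ρr p) ⟩
      β * (ρ p * r p) ∎
      where
      open ≡-Reasoning
      at : A p p * (α * r p) ≡ β * (A p p * r p)
      at rewrite A-diagonal p =
        solve 3 (λ a b r → con 0ℚ :* (a :* r) := b :* (con 0ℚ :* r)) refl α β (r p)

    -- Rows other than p satisfy ρ i ≤ b; stretching r by c at p and by b
    -- elsewhere balances the large row p against the rest. The diagonal entry
    -- A p p vanishes, so row p does not see its own stretching.
    eigenvalue-≤-mean : ∀ {p b c} → (∀ {i} → i ≢ p → ρ i ≤ b) → 0ℚ < b → b ≤ c →
      ρ p * b ≤ c * c → ∀ {μ} → IsEigenvalue A μ → μ ≤ᴿ fromℚ c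
    eigenvalue-≤-mean {p} {b} {c} ρ≤b 0<b b≤c ab≤c² =
      eigenvalue-≤ (rescale-pos 0<c 0<b) (rescale-elim (λ i t → (A · z) i ≤ c * t) at off)
      where
      open ≤-Reasoning
      0<c : 0ℚ < c
      0<c = <-≤-trans 0<b b≤c
      z : Fin n → ℚ
      z = rescale p c b
      at : (A · z) p ≤ c * (c * r p)
      at = begin
        (A · z) p        ≡⟨ rescale-row p c b ⟩
        b * (ρ p * r p)  ≡⟨ solve 3 (λ b a r → b :* (a :* r) := a :* b :* r) refl b (ρ p) (r p) ⟩
        ρ p * b * r p    ≤⟨ *-monoʳ-≤ (<⇒≤ (0<r p)) ab≤c² ⟩
        c * c * r p      ≡⟨ *-assoc c c (r p) ⟩
        c * (c * r p)    ∎
      z≤cr : ∀ j → z j ≤ c * r j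
      z≤cr = rescale-elim (λ j t → t ≤ c * r j) ≤-refl (λ {j} _ → *-monoʳ-≤ (<⇒≤ (0<r j)) b≤c)
      off : ∀ {i} → i ≢ p → (A · z) i ≤ c * (b * r i)
      off {i} i≢p = begin
        (A · z) i
          ≤⟨ sum-mono-≤ (λ j → *-monoˡ-≤ (A-nonneg i j) (z≤cr j)) ⟩
        sum (λ j → A i j * (c * r j))
          ≡⟨ sum-cong-≗ (λ j → solve 3 (λ a c r → a :* (c :* r) := c :* (a :* r)) refl (A i j) c (r j)) ⟩
        sum (λ j → c * (A i j * r j))
          ≡⟨ *-distribˡ-sum c (λ j → A i j * r j) ⟨
        c * (A · r) i
          ≡⟨ cong (c *_) (Ar≡ρr i) ⟩
        c * (ρ i * r i)
          ≤⟨ *-monoˡ-≤ (<⇒≤ 0<c) (*-monoʳ-≤ (<⇒≤ (0<r i)) (ρ≤b i≢p)) ⟩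
        c * (b * r i) ∎

    -- All eigenvalues are bounded by a rational c strictly below √q. The second
    -- rational k separates c from √q, so that no square root is mentioned.
    SpectrumBelow√ : ℚ → Set
    SpectrumBelow√ q = ∃[ c ] ∃[ k ] (c < k × 0ℚ ≤ k × k * k ≤ q ×
      (∀ {μ} → IsEigenvalue A μ → μ ≤ᴿ fromℚ c))

    -- Here r is stretched by a = ρ p at p and by c elsewhere, with c possibly
    -- below √(ρ p * b). A row i other than p gains (a - c) times the part of
    -- A · r that does not come from p, and this gain pays for c² < ρ p * b.
    distinct-supersolution : ∀ {p b c η} → (∀ {i} → i ≢ p → ρ i ≤ b) →
      0ℚ < c → c ≤ ρ p → ρ p * b ≤ c * c + η * (ρ p - c) →
      (∀ i → η * r i ≤ (A · rescale p 0ℚ 1ℚ) i) →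
      ∀ i → (A · rescale p (ρ p) c) i ≤ c * rescale p (ρ p) c i
    distinct-supersolution {p} {b} {c} {η} ρ≤b 0<c c≤a ab≤ ηr≤Ag =
      rescale-elim (λ i t → (A · z) i ≤ c * t) at off
      where
      open ≤-Reasoning
      a : ℚ
      a = ρ p
      z g : Fin n → ℚ
      z = rescale p a c
      g = rescale p 0ℚ 1ℚ
      at : (A · z) p ≤ c * (a * r p)
      at = ≤-reflexive (rescale-row p a c)
      ar-[a-c]g≡z : ∀ j → a * r j + (- (a - c)) * g j ≡ z j
      ar-[a-c]g≡z j with does (j Fin.≟ p)
      ... | true = solve 3 (λ a c r → a :* r :+ (:- (a :- c)) :* (con 0ℚ :* r) := a :* r) refl a c (r j)
      ... | false = solve 3 (λ a c r → a :* r :+ (:- (a :- c)) :* (con 1ℚ :* r) := c :* r) refl a c (r j)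
      off : ∀ {i} → i ≢ p → (A · z) i ≤ c * (c * r i)
      off {i} i≢p = begin
        (A · z) i
          ≡⟨ sum-cong-≗ (λ j → cong (A i j *_) (ar-[a-c]g≡z j)) ⟨
        (A · (λ j → a * r j + (- (a - c)) * g j)) i
          ≡⟨ ·-linear A a (- (a - c)) r g i ⟩
        a * (A · r) i + (- (a - c)) * (A · g) i
          ≡⟨ cong₂ (λ s t → a * s + t) (Ar≡ρr i) (sym (neg-distribˡ-* (a - c) ((A · g) i))) ⟩
        a * (ρ i * r i) - (a - c) * (A · g) i
          ≤⟨ +-mono-≤ (*-monoˡ-≤ (<⇒≤ (0<ρ p)) (*-monoʳ-≤ (<⇒≤ (0<r i)) (ρ≤b i≢p)))
               (neg-antimono-≤ (*-monoˡ-≤ (p≤q⇒0≤q-p c≤a) (ηr≤Ag i))) ⟩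
        a * (b * r i) - (a - c) * (η * r i)
          ≡⟨ cong (_- (a - c) * (η * r i)) (*-assoc a b (r i)) ⟨
        a * b * r i - (a - c) * (η * r i)
          ≤⟨ +-monoˡ-≤ (- ((a - c) * (η * r i))) (*-monoʳ-≤ (<⇒≤ (0<r i)) ab≤) ⟩
        (c * c + η * (a - c)) * r i - (a - c) * (η * r i)
          ≡⟨ solve 4 (λ a c η r → (c :* c :+ η :* (a :- c)) :* r :- (a :- c) :* (η :* r) :=
               c :* (c :* r)) refl a c η (r i) ⟩
        c * (c * r i) ∎

    -- The case of a strict maximum of ρ at p. A third index makes the part of
    -- A · r away from p positive in every row.
    gap-distinct : (∀ i p → ∃[ k ] (k ≢ i × k ≢ p)) →
      ∀ {p b} → (∀ {i} → i ≢ p → ρ i ≤ b) → 0ℚ < b → b < ρ p →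
      SpectrumBelow√ (ρ p * b)
    gap-distinct another {p} {b} ρ≤b 0<b b<a =
      let η , 0<η , ηr≤Ag = quotient-minorant (A · g) r 0<Ag 0<r
          c , 0<c , c≤a , c²<ab , ab≤ = below-geometric-mean 0<b b<a 0<η
          δ , 0<δ , increment = square-increment (<⇒≤ 0<c) (p<q⇒0<q-p c²<ab)
      in c , c + δ , <-by δ 0<δ refl , nonneg-+ (<⇒≤ 0<c) (<⇒≤ 0<δ)
         , subst ((c + δ) * (c + δ) ≤_)
             (solve 2 (λ s q → s :+ (q :- s) := q) refl (c * c) (ρ p * b))
             (increment (<⇒≤ 0<c) ≤-refl)
         , eigenvalue-≤ (rescale-pos (0<ρ p) 0<c)
             (distinct-supersolution {η = η} ρ≤b 0<c c≤a ab≤ ηr≤Ag)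
      where
      g : Fin n → ℚ
      g = rescale p 0ℚ 1ℚ
      0≤g : ∀ j → 0ℚ ≤ g j
      0≤g = rescale-elim (λ _ t → 0ℚ ≤ t) (nonneg-* ≤-refl (<⇒≤ (0<r p)))
        (λ {j} _ → nonneg-* (nonNegative⁻¹ 1ℚ) (<⇒≤ (0<r j)))
      0<Ag : ∀ i → 0ℚ < (A · g) i
      0<Ag i = let k , k≢i , k≢p = another i p in
        sum-pos (λ j → nonneg-* (A-nonneg i j) (0≤g j)) k
          (pos-* (A-positive (≢-sym k≢i))
            (subst (0ℚ <_) (sym (rescale-off 0ℚ 1ℚ k≢p)) (pos-* (positive⁻¹ 1ℚ) (0<r k))))

    -- The case where the two largest values of ρ agree. The vector r satisfies
    -- Ar ≤ ar with slack w = ar - Ar, nonzero at k. Applying A spreads the slack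
    -- to every row: z = r + Ar has slack w + Aw, which is positive everywhere.
    gap-equal : ∀ {p k} → (∀ i → ρ i ≤ ρ p) → ρ k < ρ p → SpectrumBelow√ (ρ p * ρ p)
    gap-equal {p} {k} ρ≤a ρk<a =
      let η , 0<η , ηz≤ = quotient-minorant slack z 0<slack 0<z
      in a - η , a , <-by η 0<η (sym (p≡[p-q]+q a η)) , <⇒≤ (0<ρ p) , ≤-refl
         , eigenvalue-≤ 0<z (row η ηz≤)
      where
      a : ℚ
      a = ρ p
      t z w slack : Fin n → ℚ
      t i = ρ i * r i
      z i = 1ℚ * r i + 1ℚ * t i
      w i = a * r i + (- 1ℚ) * t i
      slack i = w i + (A · w) i
      0<z : ∀ i → 0ℚ < z i
      0<z i = pos-+ (pos-* (positive⁻¹ 1ℚ) (0<r i))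
        (nonneg-* (nonNegative⁻¹ 1ℚ) (<⇒≤ (pos-* (0<ρ i) (0<r i))))
      w≡ : ∀ i → (a - ρ i) * r i ≡ w i
      w≡ i = solve 3 (λ a ρ r → (a :- ρ) :* r := a :* r :+ (:- con 1ℚ) :* (ρ :* r)) refl a (ρ i) (r i)
      0≤w : ∀ i → 0ℚ ≤ w i
      0≤w i = subst (0ℚ ≤_) (w≡ i) (nonneg-* (p≤q⇒0≤q-p (ρ≤a i)) (<⇒≤ (0<r i)))
      0<wk : 0ℚ < w k
      0<wk = subst (0ℚ <_) (w≡ k) (pos-* (p<q⇒0<q-p ρk<a) (0<r k))
      0<slack : ∀ i → 0ℚ < slack i
      0<slack i with i Fin.≟ k
      ... | yes refl = pos-+ 0<wk (·-nonneg A-nonneg 0≤w i)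
      ... | no i≢k = subst (0ℚ <_) (+-comm ((A · w) i) (w i)) (pos-+
            (sum-pos (λ j → nonneg-* (A-nonneg i j) (0≤w j)) k (pos-* (A-positive i≢k) 0<wk)) (0≤w i))
      Az≡ : ∀ i → (A · z) i ≡ a * z i - slack i
      Az≡ i = begin
        (A · z) i
          ≡⟨ ·-linear A 1ℚ 1ℚ r t i ⟩
        1ℚ * (A · r) i + 1ℚ * (A · t) i
          ≡⟨ cong (λ s → 1ℚ * s + 1ℚ * (A · t) i) (Ar≡ρr i) ⟩
        1ℚ * t i + 1ℚ * (A · t) i
          ≡⟨ solve 4 (λ a r t At → con 1ℚ :* t :+ con 1ℚ :* At :=
               a :* (con 1ℚ :* r :+ con 1ℚ :* t) :-
               ((a :* r :+ (:- con 1ℚ) :* t) :+ (a :* t :+ (:- con 1ℚ) :* At)))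
               refl a (r i) (t i) ((A · t) i) ⟩
        a * z i - (w i + (a * t i + (- 1ℚ) * (A · t) i))
          ≡⟨ cong (λ s → a * z i - (w i + (a * s + (- 1ℚ) * (A · t) i))) (Ar≡ρr i) ⟨
        a * z i - (w i + (a * (A · r) i + (- 1ℚ) * (A · t) i))
          ≡⟨ cong (λ s → a * z i - (w i + s)) (·-linear A a (- 1ℚ) r t i) ⟨
        a * z i - slack i ∎
        where open ≡-Reasoning
      row : ∀ η → (∀ i → η * z i ≤ slack i) → ∀ i → (A · z) i ≤ (a - η) * z i
      row η ηz≤ i = begin
        (A · z) i          ≡⟨ Az≡ i ⟩
        a * z i - slack i  ≤⟨ +-monoʳ-≤ (a * z i) (neg-antimono-≤ (ηz≤ i)) ⟩
        a * z i - η * z i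
          ≡⟨ solve 3 (λ a η z → a :* z :- η :* z := (a :- η) :* z) refl a η (z i) ⟩
        (a - η) * z i      ∎
        where open ≤-Reasoning

    gap : (∀ i p → ∃[ k ] (k ≢ i × k ≢ p)) →
      ∀ {p q} → (∀ i → ρ i ≤ ρ p) → (∀ {i} → i ≢ p → ρ i ≤ ρ q) →
      ¬ (∀ i → ρ i ≡ ρ p) → SpectrumBelow√ (ρ p * ρ q)
    gap another {p} {q} ρ≤ρp ρ≤ρq irregular with ρ q ≟ ρ p
    ... | no ρq≢ρp = gap-distinct another ρ≤ρq (0<ρ q) (≤∧≢⇒< (ρ≤ρp q) ρq≢ρp)
    ... | yes ρq≡ρp =
      let k , ρk≢ρp = Fin.¬∀⟶∃¬ n (λ i → ρ i ≡ ρ p) (λ i → ρ i ≟ ρ p) irregular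
      in subst (λ b → SpectrumBelow√ (ρ p * b)) (sym ρq≡ρp)
           (gap-equal ρ≤ρp (≤∧≢⇒< (ρ≤ρp k) ρk≢ρp))

    eigenvalue-≤-sqrt : ∀ {p q s} → (∀ i → ρ i ≤ ρ p) → (∀ {i} → i ≢ p → ρ i ≤ ρ q) →
      IsSqrt (fromℚ (ρ p * ρ q)) s → ∀ {μ} → IsEigenvalue A μ → μ ≤ᴿ s
    eigenvalue-≤-sqrt {p} {q} ρ≤ρp ρ≤ρq s=√ eigen = ≤ᴿ-by-approximation λ δ 0<δ →
      let k , 0≤k , k²<ab , ab≤ = sqrt-bracket (pos-* (0<ρ p) (0<ρ q)) 0<δ
          b²≤ab = *-monoʳ-≤ (<⇒≤ (0<ρ q)) (ρ≤ρp q)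
      in k , ≤-sqrt s=√ 0≤k (<⇒≤ k²<ab)
         , eigenvalue-≤-mean ρ≤ρq (0<ρ q)
             (*-cancel-sq-≤ (nonneg-+ 0≤k (<⇒≤ 0<δ)) (≤-trans b²≤ab ab≤)) ab≤ eigen

  -- Matrix products and Moore-Penrose inverses of symmetric matrices

  ≐-setoid : ℕ → Setoid 0ℓ 0ℓ
  ≐-setoid n = record
    { Carrier = Matrix n
    ; _≈_ = _≐_
    ; isEquivalence = record
      { refl = λ _ _ → refl
      ; sym = λ h i j → sym (h i j)
      ; trans = λ h k i j → trans (h i j) (k i j)
      }
    }

  ⊗-assoc : ∀ {n} (A B C : Matrix n) → A ⊗ B ⊗ C ≐ A ⊗ (B ⊗ C)
  ⊗-assoc A B C i j = begin
    sum (λ k → sum (λ l → A i l * B l k) * C k j)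
      ≡⟨ sum-cong-≗ (λ k → *-distribʳ-sum (C k j) (λ l → A i l * B l k)) ⟩
    sum (λ k → sum (λ l → A i l * B l k * C k j))
      ≡⟨ ∑-comm (λ k l → A i l * B l k * C k j) ⟩
    sum (λ l → sum (λ k → A i l * B l k * C k j))
      ≡⟨ sum-cong-≗ (λ l → sum-cong-≗ (λ k → *-assoc (A i l) (B l k) (C k j))) ⟩
    sum (λ l → sum (λ k → A i l * (B l k * C k j)))
      ≡⟨ sum-cong-≗ (λ l → *-distribˡ-sum (A i l) (λ k → B l k * C k j)) ⟨
    sum (λ l → A i l * sum (λ k → B l k * C k j)) ∎
    where open ≡-Reasoning

  ⊗-congˡ : ∀ {n} (A : Matrix n) {B C} → B ≐ C → A ⊗ B ≐ A ⊗ C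
  ⊗-congˡ A B≐C i j = sum-cong-≗ (λ k → cong (A i k *_) (B≐C k j))

  ⊗-congʳ : ∀ {n} (C : Matrix n) {A B} → A ≐ B → A ⊗ C ≐ B ⊗ C
  ⊗-congʳ C A≐B i j = sum-cong-≗ (λ k → cong (_* C k j) (A≐B i k))

  ⊗-ᵀ : ∀ {n} (A B : Matrix n) → (A ⊗ B) ᵀ ≐ B ᵀ ⊗ A ᵀ
  ⊗-ᵀ A B i j = sum-cong-≗ (λ k → *-comm (A j k) (B k i))

  -- A symmetric matrix L and its Moore-Penrose inverse X.
  module MoorePenrose {n} {L X : Matrix n} (L-sym : L ᵀ ≐ L)
    (isInverse : IsMoorePenroseInverse L X) where

    open IsMoorePenroseInverse isInverse
    open SetoidReasoning (≐-setoid n)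

    XL⊗L≐L : X ⊗ L ⊗ L ≐ L
    XL⊗L≐L = begin
      X ⊗ L ⊗ L          ≈⟨ ⊗-congʳ L XA-selfᵀ ⟨
      (X ⊗ L) ᵀ ⊗ L      ≈⟨ ⊗-congˡ ((X ⊗ L) ᵀ) L-sym ⟨
      (X ⊗ L) ᵀ ⊗ L ᵀ    ≈⟨ ⊗-ᵀ L (X ⊗ L) ⟨
      (L ⊗ (X ⊗ L)) ᵀ    ≈⟨ (λ i j → trans (sym (⊗-assoc L X L j i)) (AXA≐A j i)) ⟩
      L ᵀ                ≈⟨ L-sym ⟩
      L                  ∎

    L⊗LX≐L : L ⊗ (L ⊗ X) ≐ L
    L⊗LX≐L = begin
      L ⊗ (L ⊗ X)        ≈⟨ ⊗-congˡ L AX-selfᵀ ⟨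
      L ⊗ (L ⊗ X) ᵀ      ≈⟨ ⊗-congʳ ((L ⊗ X) ᵀ) L-sym ⟨
      L ᵀ ⊗ (L ⊗ X) ᵀ    ≈⟨ ⊗-ᵀ (L ⊗ X) L ⟨
      (L ⊗ X ⊗ L) ᵀ      ≈⟨ (λ i j → AXA≐A j i) ⟩
      L ᵀ                ≈⟨ L-sym ⟩
      L                  ∎

    -- LX and XL are the orthogonal projections onto the range of L and of its
    -- transpose, which coincide for symmetric L.
    LX≐XL : L ⊗ X ≐ X ⊗ L
    LX≐XL = begin
      L ⊗ X              ≈⟨ ⊗-congʳ X XL⊗L≐L ⟨
      X ⊗ L ⊗ L ⊗ X      ≈⟨ ⊗-assoc (X ⊗ L) L X ⟩
      X ⊗ L ⊗ (L ⊗ X)    ≈⟨ ⊗-assoc X L (L ⊗ X) ⟩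
      X ⊗ (L ⊗ (L ⊗ X))  ≈⟨ ⊗-congˡ X L⊗LX≐L ⟩
      X ⊗ L              ∎

    X-sym : X ᵀ ≐ X
    X-sym = begin
      X ᵀ                ≈⟨ (λ i j → sym (XAX≐X j i)) ⟩
      (X ⊗ L ⊗ X) ᵀ      ≈⟨ ⊗-ᵀ (X ⊗ L) X ⟩
      X ᵀ ⊗ (X ⊗ L) ᵀ    ≈⟨ ⊗-congˡ (X ᵀ) XA-selfᵀ ⟩
      X ᵀ ⊗ (X ⊗ L)      ≈⟨ ⊗-congˡ (X ᵀ) LX≐XL ⟨
      X ᵀ ⊗ (L ⊗ X)      ≈⟨ ⊗-assoc (X ᵀ) L X ⟨
      X ᵀ ⊗ L ⊗ X        ≈⟨ ⊗-congʳ X (⊗-congˡ (X ᵀ) L-sym) ⟨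
      X ᵀ ⊗ L ᵀ ⊗ X      ≈⟨ ⊗-congʳ X (⊗-ᵀ L X) ⟨
      (L ⊗ X) ᵀ ⊗ X      ≈⟨ ⊗-congʳ X AX-selfᵀ ⟩
      L ⊗ X ⊗ X          ≈⟨ ⊗-congʳ X LX≐XL ⟩
      X ⊗ L ⊗ X          ≈⟨ XAX≐X ⟩
      X                  ∎

    resistance-diagonal : ∀ i → resistanceMatrix X i i ≡ 0ℚ
    resistance-diagonal i = solve 1 (λ x → x :+ x :- con (ℤ.+ 2 / 1) :* x := con 0ℚ) refl (X i i)

    resistance-sym : ∀ i j → resistanceMatrix X i j ≡ resistanceMatrix X j i
    resistance-sym i j = cong₂ (λ s t → s - (ℤ.+ 2 / 1) * t) (+-comm (X i i) (X j j)) (X-sym j i)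

    -- Column i minus column j of X: if L is the Laplacian of a connected graph,
    -- the potential of a unit current from i to j.
    potential : Fin n → Fin n → Fin n → ℚ
    potential i j k = X k i - X k j

    L·potential : ∀ i j k → (L · potential i j) k ≡ (L ⊗ X) k i - (L ⊗ X) k j
    L·potential i j k = trans
      (sum-cong-≗ (λ l → *-distribˡ-- (L k l) (X l i) (X l j)))
      (sum-minus (λ l → L k l * X l i) (λ l → L k l * X l j))

    -- The resistance distance is the energy uᵀLu of the potential u.
    resistance-energy : ∀ i j → sum (λ k → potential i j k * (L · potential i j) k) ≡ resistanceMatrix X i j
    resistance-energy i j = R.begin
      sum (λ k → potential i j k * (L · potential i j) k)
        R.≡⟨ sum-cong-≗ (λ k → trans (cong (potential i j k *_) (L·potential i j k))
             (solve 4 (λ x y p q → (x :- y) :* (p :- q) := x :* p :- x :* q :- (y :* p :- y :* q)) refl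
               (X k i) (X k j) (P k i) (P k j))) ⟩
      sum (λ k → X k i * P k i - X k i * P k j - (X k j * P k i - X k j * P k j))
        R.≡⟨ trans (sum-minus (λ k → X k i * P k i - X k i * P k j) (λ k → X k j * P k i - X k j * P k j))
             (cong₂ _-_ (sum-minus (λ k → X k i * P k i) (λ k → X k i * P k j))
                (sum-minus (λ k → X k j * P k i) (λ k → X k j * P k j))) ⟩
      (X ᵀ ⊗ P) i i - (X ᵀ ⊗ P) i j - ((X ᵀ ⊗ P) j i - (X ᵀ ⊗ P) j j)
        R.≡⟨ cong₂ _-_ (cong₂ _-_ (XᵀP≐X i i) (XᵀP≐X i j)) (cong₂ _-_ (XᵀP≐X j i) (XᵀP≐X j j)) ⟩
      X i i - X i j - (X j i - X j j)
        R.≡⟨ cong (λ t → X i i - X i j - (t - X j j)) (X-sym i j) ⟩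
      X i i - X i j - (X i j - X j j)
        R.≡⟨ solve 3 (λ a b c → a :- c :- (c :- b) := a :+ b :- con (ℤ.+ 2 / 1) :* c) refl
              (X i i) (X j j) (X i j) ⟩
      resistanceMatrix X i j R.∎
      where
      module R = ≡-Reasoning
      P : Matrix n
      P = L ⊗ X
      XᵀP≐X : X ᵀ ⊗ P ≐ X
      XᵀP≐X = begin
        X ᵀ ⊗ (L ⊗ X)  ≈⟨ ⊗-congʳ (L ⊗ X) X-sym ⟩
        X ⊗ (L ⊗ X)    ≈⟨ ⊗-assoc X L X ⟨
        X ⊗ L ⊗ X      ≈⟨ XAX≐X ⟩
        X              ∎

    -- If Lu = 0 for the potential u, then LX has equal columns i and j, and so
    -- has L = L(LX).
    harmonic-potential⇒equal-columns : ∀ {i j} → (∀ k → (L · potential i j) k ≡ 0ℚ) → ∀ k → L k i ≡ L k j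
    harmonic-potential⇒equal-columns {i} {j} h k = R.begin
      L k i                          R.≡⟨ L⊗LX≐L k i ⟨
      sum (λ l → L k l * (L ⊗ X) l i)
        R.≡⟨ sum-cong-≗ (λ l → cong (L k l *_) (column l)) ⟩
      sum (λ l → L k l * (L ⊗ X) l j)  R.≡⟨ L⊗LX≐L k j ⟩
      L k j                          R.∎
      where
      module R = ≡-Reasoning
      column : ∀ l → (L ⊗ X) l i ≡ (L ⊗ X) l j
      column l = trans (p≡[p-q]+q ((L ⊗ X) l i) ((L ⊗ X) l j))
        (trans (cong (_+ (L ⊗ X) l j) (trans (sym (L·potential i j l)) (h l))) (+-identityˡ _))

  -- The Laplacian of a graph

  module GraphLaplacian {n} (G : SimpleGraph n) where
    open SimpleGraph G

    -- The adjacency matrix and the Laplacian of G.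
    a L : Matrix n
    a = adjacency G
    L = laplacian G

    a-nonneg : ∀ i j → 0ℚ ≤ a i j
    a-nonneg i j with does (i ~? j)
    ... | true = nonNegative⁻¹ 1ℚ
    ... | false = ≤-refl

    a-edge : ∀ {i j} → i ~ j → a i j ≡ 1ℚ
    a-edge {i} {j} e = cong (if_then 1ℚ else 0ℚ) (dec-true (i ~? j) e)

    a-irr : ∀ i → a i i ≡ 0ℚ
    a-irr i = cong (if_then 1ℚ else 0ℚ) (dec-false (i ~? i) (~-irr refl))

    a-sym : ∀ i j → a i j ≡ a j i
    a-sym i j with i ~? j | j ~? i
    ... | yes _ | yes _ = refl
    ... | no _  | no _  = refl
    ... | yes e | no ¬e = ⊥-elim (¬e (~-sym e))
    ... | no ¬e | yes e = ⊥-elim (¬e (~-sym e))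

    L-diagonal : ∀ i → L i i ≡ degree G i
    L-diagonal i = trans
      (cong₂ _-_ (cong (if_then degree G i else 0ℚ) (dec-true (i Fin.≟ i) refl)) (a-irr i))
      (+-identityʳ _)

    L-off-diagonal : ∀ {i j} → i ≢ j → L i j ≡ - a i j
    L-off-diagonal {i} {j} i≢j = trans
      (cong (λ b → (if b then degree G i else 0ℚ) - a i j) (dec-false (i Fin.≟ j) i≢j))
      (+-identityˡ _)

    L-sym : L ᵀ ≐ L
    L-sym i j = cong₂ _-_ degreeMatrix-sym (a-sym j i)
      where
      degreeMatrix-sym : degreeMatrix G j i ≡ degreeMatrix G i j
      degreeMatrix-sym with j Fin.≟ i | i Fin.≟ j
      ... | yes refl | yes _ = refl
      ... | no _     | no _  = refl
      ... | yes refl | no i≢i = ⊥-elim (i≢i refl)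
      ... | no i≢i   | yes refl = ⊥-elim (i≢i refl)

    L·v : ∀ v i → (L · v) i ≡ sum (λ j → a i j * (v i - v j))
    L·v v i = begin
      sum (λ j → (degreeMatrix G i j - a i j) * v j)
        ≡⟨ sum-cong-≗ (λ j → solve 3 (λ d a v → (d :- a) :* v := d :* v :- a :* v) refl (degreeMatrix G i j) (a i j) (v j)) ⟩
      sum (λ j → degreeMatrix G i j * v j - a i j * v j)
        ≡⟨ sum-minus (λ j → degreeMatrix G i j * v j) (λ j → a i j * v j) ⟩
      sum (λ j → degreeMatrix G i j * v j) - sum (λ j → a i j * v j)
        ≡⟨ cong (_- sum (λ j → a i j * v j)) (trans (sum-delta i (degree G i) v) (*-distribʳ-sum (v i) (a i))) ⟩
      sum (λ j → a i j * v i) - sum (λ j → a i j * v j)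
        ≡⟨ sum-minus (λ j → a i j * v i) (λ j → a i j * v j) ⟨
      sum (λ j → a i j * v i - a i j * v j)
        ≡⟨ sum-cong-≗ (λ j → *-distribˡ-- (a i j) (v i) (v j)) ⟨
      sum (λ j → a i j * (v i - v j)) ∎
      where open ≡-Reasoning

    -- Twice the quadratic form of the Laplacian is the sum of (vᵢ - vⱼ)² over
    -- ordered pairs of adjacent vertices.
    dirichlet : ∀ v → sum (λ i → v i * (L · v) i) + sum (λ i → v i * (L · v) i) ≡
      sum (λ i → sum (λ j → a i j * ((v i - v j) * (v i - v j))))
    dirichlet v = begin
      E + E
        ≡⟨ cong₂ _+_ E≡ (trans E≡ (trans (∑-comm (λ i j → v i * (a i j * (v i - v j))))
             (sum-cong-≗ (λ i → sum-cong-≗ (λ j → cong (λ t → v j * (t * (v j - v i))) (a-sym j i)))))) ⟩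
      sum (λ i → sum (λ j → v i * (a i j * (v i - v j)))) + sum (λ i → sum (λ j → v j * (a i j * (v j - v i))))
        ≡⟨ ∑-distrib-+ (λ i → sum (λ j → v i * (a i j * (v i - v j)))) (λ i → sum (λ j → v j * (a i j * (v j - v i)))) ⟨
      sum (λ i → sum (λ j → v i * (a i j * (v i - v j))) + sum (λ j → v j * (a i j * (v j - v i))))
        ≡⟨ sum-cong-≗ (λ i → trans
             (sym (∑-distrib-+ (λ j → v i * (a i j * (v i - v j))) (λ j → v j * (a i j * (v j - v i)))))
             (sum-cong-≗ (λ j → solve 3 (λ a x y → x :* (a :* (x :- y)) :+ y :* (a :* (y :- x)) :=
                a :* ((x :- y) :* (x :- y))) refl (a i j) (v i) (v j)))) ⟩
      sum (λ i → sum (λ j → a i j * ((v i - v j) * (v i - v j)))) ∎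
      where
      open ≡-Reasoning
      E : ℚ
      E = sum (λ i → v i * (L · v) i)
      E≡ : E ≡ sum (λ i → sum (λ j → v i * (a i j * (v i - v j))))
      E≡ = sum-cong-≗ (λ i → trans (cong (v i *_) (L·v v i))
        (*-distribˡ-sum (v i) (λ j → a i j * (v i - v j))))

    zero-energy⇒harmonic : ∀ v → sum (λ i → v i * (L · v) i) ≤ 0ℚ → ∀ i → (L · v) i ≡ 0ℚ
    zero-energy⇒harmonic v E≤0 i = trans (L·v v i)
      (trans (sum-cong-≗ edge) (sum-replicate-zero n))
      where
      e : Fin n → Fin n → ℚ
      e i j = a i j * ((v i - v j) * (v i - v j))
      0≤e : ∀ i j → 0ℚ ≤ e i j
      0≤e i j = nonneg-* (a-nonneg i j) (0≤p*p (v i - v j))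
      e≤0 : ∀ j → e i j ≤ 0ℚ
      e≤0 j = ≤-trans (term≤sum (0≤e i) j)
        (≤-trans (term≤sum (λ i → sum-nonneg (0≤e i)) i)
          (≤-trans (≤-reflexive (sym (dirichlet v))) (+-mono-≤ E≤0 E≤0)))
      edge : ∀ j → a i j * (v i - v j) ≡ 0ℚ
      edge j = a*t²≤0⇒a*t≡0 (a-nonneg i j) (e≤0 j)

    degree-pos : Connected G → ∀ {i j} → i ≢ j → 0ℚ < degree G i
    degree-pos connected {i} {j} i≢j with connected i j
    ... | Star.ε = ⊥-elim (i≢j refl)
    ... | Star._◅_ {j = k} e _ = sum-pos (a-nonneg i) k (subst (0ℚ <_) (sym (a-edge e)) (positive⁻¹ 1ℚ))

    -- A potential of nonpositive energy is annihilated by L. Then columns i and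
    -- j of L agree; but at row i they are the positive degree of i and a number
    -- that is at most 0.
    resistance-pos : Connected G → ∀ {X} → IsMoorePenroseInverse L X →
      ∀ {i j} → i ≢ j → 0ℚ < resistanceMatrix X i j
    resistance-pos connected {X} isInverse {i} {j} i≢j with 0ℚ <? resistanceMatrix X i j
    ... | yes pos = pos
    ... | no ¬pos = ⊥-elim (<-irrefl refl (<-≤-trans (degree-pos connected i≢j) (begin
        degree G i  ≡⟨ L-diagonal i ⟨
        L i i       ≡⟨ harmonic-potential⇒equal-columns
                         (zero-energy⇒harmonic (potential i j)
                           (≤-trans (≤-reflexive (resistance-energy i j)) (≮⇒≥ ¬pos))) i ⟩
        L i j       ≡⟨ L-off-diagonal i≢j ⟩
        - a i j     ≤⟨ neg-antimono-≤ (a-nonneg i j) ⟩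
        0ℚ          ∎)))
      where
      open MoorePenrose L-sym isInverse
      open ≤-Reasoning

  -- The largest eigenvalue and the geometric means of row quotients

  -- For a symmetric 2 × 2 matrix with zero diagonal and r its row sums, both
  -- row quotients equal the off-diagonal entry.
  two-vertices-regular : {A : Matrix 2} {ρ : Fin 2 → ℚ} →
    (∀ i j → A i j ≡ A j i) → (∀ i → A i i ≡ 0ℚ) → (∀ i → 0ℚ < sum (A i)) →
    (∀ i → (A · (λ j → sum (A j))) i ≡ ρ i * sum (A i)) → ∀ i j → ρ i ≡ ρ j
  two-vertices-regular {A} {ρ} A-sym A-diagonal 0<r Ar≡ρr i j = trans (ρ≡x i) (sym (ρ≡x j))
    where
    x : ℚ
    x = A zero (suc zero)
    r≡x : ∀ i → sum (A i) ≡ x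
    r≡x zero = trans (cong₂ _+_ (A-diagonal zero) (+-identityʳ x)) (+-identityˡ x)
    r≡x (suc zero) = trans
      (cong₂ _+_ (A-sym (suc zero) zero) (trans (+-identityʳ _) (A-diagonal (suc zero))))
      (+-identityʳ x)
    0<x : 0ℚ < x
    0<x = subst (0ℚ <_) (r≡x zero) (0<r zero)
    ρ≡x : ∀ i → ρ i ≡ x
    ρ≡x i = ≤-antisym (*-cancelˡ-≤ 0<x (≤-reflexive eq)) (*-cancelˡ-≤ 0<x (≤-reflexive (sym eq)))
      where
      open ≡-Reasoning
      eq : x * ρ i ≡ x * x
      eq = begin
        x * ρ i                            ≡⟨ *-comm x (ρ i) ⟩
        ρ i * x                            ≡⟨ cong (ρ i *_) (r≡x i) ⟨
        ρ i * sum (A i)                    ≡⟨ Ar≡ρr i ⟨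
        sum (λ j → A i j * sum (A j))      ≡⟨ sum-cong-≗ (λ j → trans (cong (A i j *_) (r≡x j)) (*-comm (A i j) x)) ⟩
        sum (λ j → x * A i j)              ≡⟨ *-distribˡ-sum x (A i) ⟨
        x * sum (A i)                      ≡⟨ cong (x *_) (r≡x i) ⟩
        x * x                              ∎

  -- The argument for the equality case needs a third index; without one the
  -- row quotients are equal anyway.
  regular-or-third : ∀ n {A : Matrix (2 ℕ.+ n)} {ρ : Fin (2 ℕ.+ n) → ℚ} →
    (∀ i j → A i j ≡ A j i) → (∀ i → A i i ≡ 0ℚ) → (∀ i → 0ℚ < sum (A i)) →
    (∀ i → (A · (λ j → sum (A j))) i ≡ ρ i * sum (A i)) →
    (∀ i j → ρ i ≡ ρ j) ⊎ (∀ (i p : Fin (2 ℕ.+ n)) → ∃[ k ] (k ≢ i × k ≢ p))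
  regular-or-third zero {A} A-sym A-diagonal 0<r Ar≡ρr =
    inj₁ (two-vertices-regular {A} A-sym A-diagonal 0<r Ar≡ρr)
  regular-or-third (suc n) _ _ _ _ = inj₂ third

  ÷₀-cancel : ∀ p {q} → 0ℚ < q → (p ÷₀ q) * q ≡ p
  ÷₀-cancel p {q} 0<q with q ≟ 0ℚ
  ... | yes q≡0 = ⊥-elim (<-irrefl (sym q≡0) 0<q)
  ... | no q≢0 = trans (*-assoc p _ q)
    (trans (cong (p *_) (*-inverseˡ q {{≢-nonZero q≢0}})) (*-identityʳ p))

  -- The setting of Spectrum with r the vector of row sums of A, so that ρ i is
  -- the average of the row sums with weights taken from row i.
  module Comparison {n} (A : Matrix (2 ℕ.+ n))
    (A-sym : ∀ i j → A i j ≡ A j i)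
    (A-diagonal : ∀ i → A i i ≡ 0ℚ)
    (A-positive : ∀ {i j} → i ≢ j → 0ℚ < A i j)
    (ρ : Fin (2 ℕ.+ n) → ℚ) (0<ρ : ∀ i → 0ℚ < ρ i)
    (0<r : ∀ i → 0ℚ < sum (A i))
    (Ar≡ρr : ∀ i → (A · (λ j → sum (A j))) i ≡ ρ i * sum (A i))
    where

    -- The square roots of ρ i * ρ j for i ≠ j.
    Means : ℝ → Set
    Means s = ∃[ i ] ∃[ j ] (i ≢ j × IsSqrt (fromℚ (ρ i * ρ j)) s)

    r : Fin (2 ℕ.+ n) → ℚ
    r i = sum (A i)

    open Spectrum A A-sym A-diagonal A-positive r 0<r ρ 0<ρ Ar≡ρr

    eigenvalue-≤-maximum : ∀ {μ m} → IsEigenvalue A μ → IsMaximum Means m → μ ≤ᴿ m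
    eigenvalue-≤-maximum eigen (_ , Means≤m) =
      let p , q , q≢p , ρ≤ρp , ρ≤ρq = argmax₂ ρ
          s , s=√ = sqrt-exists (pos-* (0<ρ p) (0<ρ q))
      in ≤ᴿ-trans (eigenvalue-≤-sqrt ρ≤ρp ρ≤ρq s=√ eigen)
           (Means≤m s (p , q , ≢-sym q≢p , s=√))

    regular⇒maximum-≤ : ∀ {k ρ₁ m} → (∀ i → ρ i ≡ k) → IsLargestEigenvalue A ρ₁ → Means m → m ≤ᴿ ρ₁
    regular⇒maximum-≤ {k} ρ≡k (_ , ≤ρ₁) (i , j , _ , m=√) = ≤ᴿ-trans
      (sqrt-≤ m=√ (subst (0ℚ ≤_) (ρ≡k i) (<⇒≤ (0<ρ i))) (≤-reflexive (cong₂ _*_ (ρ≡k i) (ρ≡k j))))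
      (≤ρ₁ (fromℚ k) (rational-eigenvalue {A = A} {v = r} i (≢-sym (<⇒≢ (0<r i)))
        (λ l → trans (Ar≡ρr l) (cong (_* r l) (ρ≡k l)))))

    -- If p and q give a gap, the spectrum ends strictly below √(ρ p * ρ q),
    -- hence strictly below the maximum of the means.
    no-gap : ∀ {p q ρ₁ m} → q ≢ p → SpectrumBelow√ (ρ p * ρ q) → IsEigenvalue A ρ₁ →
      IsMaximum Means m → ¬ m ≤ᴿ ρ₁
    no-gap {p} {q} q≢p (c , k , c<k , 0≤k , k²≤ , eigen≤c) eigen (_ , Means≤m) m≤ρ₁ =
      let s , s=√ = sqrt-exists (pos-* (0<ρ p) (0<ρ q))
          k≤s = ≤-sqrt s=√ 0≤k k²≤
          s≤m = Means≤m s (p , q , ≢-sym q≢p , s=√)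
      in <-irrefl refl (<-≤-trans c<k (fromℚ-cancel-≤
           (≤ᴿ-trans k≤s (≤ᴿ-trans s≤m (≤ᴿ-trans m≤ρ₁ (eigen≤c eigen))))))

    maximum-≤⇒regular : ∀ {ρ₁ m} → IsEigenvalue A ρ₁ → IsMaximum Means m → m ≤ᴿ ρ₁ →
      ∃[ k ] (∀ i → ρ i ≡ k)
    maximum-≤⇒regular eigen m-max m≤ρ₁ with regular-or-third n {A} A-sym A-diagonal 0<r Ar≡ρr
    ... | inj₁ regular = ρ zero , λ i → regular i zero
    ... | inj₂ another with argmax₂ ρ
    ... | p , q , q≢p , ρ≤ρp , ρ≤ρq with Fin.all? (λ i → ρ i ≟ ρ p)
    ... | yes ρ≡ρp = ρ p , ρ≡ρp
    ... | no irregular =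
      ⊥-elim (no-gap q≢p (gap another ρ≤ρp ρ≤ρq irregular) eigen m-max m≤ρ₁)

  -- Resistance matrices of connected graphs

  module Resistance {n} (G : SimpleGraph (2 ℕ.+ n)) (connected : Connected G)
    {L† : Matrix (2 ℕ.+ n)} (isInverse : IsMoorePenroseInverse (laplacian G) L†) where

    open GraphLaplacian G
    open MoorePenrose L-sym isInverse

    -- The resistance matrix, the resistance degrees, and the average resistance
    -- degrees.
    R : Matrix (2 ℕ.+ n)
    R = resistanceMatrix L†

    r ρ : Fin (2 ℕ.+ n) → ℚ
    r = resistanceDegree L†
    ρ = averageResistanceDegree L†

    R-positive : ∀ {i j} → i ≢ j → 0ℚ < R i j
    R-positive = resistance-pos connected isInverse

    R-nonneg : ∀ i j → 0ℚ ≤ R i j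
    R-nonneg = off-diagonal-pos⇒nonneg resistance-diagonal R-positive

    0<r : ∀ i → 0ℚ < r i
    0<r i = sum-pos (R-nonneg i) (punchIn i zero) (R-positive (≢-sym (Fin.punchInᵢ≢i i zero)))

    Rr≡ρr : ∀ i → (R · r) i ≡ ρ i * r i
    Rr≡ρr i = sym (÷₀-cancel (secondResistanceDegree L† i) (0<r i))

    0<ρ : ∀ i → 0ℚ < ρ i
    0<ρ i = *-cancelˡ-< (<⇒≤ (0<r i)) (subst₂ _<_ (sym (*-zeroʳ (r i)))
      (trans (Rr≡ρr i) (*-comm (ρ i) (r i))) (row-pos R-nonneg R-positive 0<r i))

    open Comparison R resistance-sym resistance-diagonal R-positive ρ 0<ρ 0<r Rr≡ρr public
      using (eigenvalue-≤-maximum; regular⇒maximum-≤; maximum-≤⇒regular)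

open Lemmas
open import Data.Nat using (_≤_)

theorem4p3 : (n : ℕ) → 2 ≤ n →
    (G : SimpleGraph n) → Connected G →
    (L† : Matrix n) → IsMoorePenroseInverse (laplacian G) L† →
    (ρ₁ : ℝ) → IsLargestEigenvalue (resistanceMatrix L†) ρ₁ →
    (m : ℝ) → IsMaximum (GeometricMeans L†) m →
    ρ₁ ≤ᴿ m × (ρ₁ ≈ᴿ m ⇔ PseudoResistanceRegular L†)
theorem4p3 (suc (suc n)) (ℕ.s≤s (ℕ.s≤s _)) G connected L† isInverse ρ₁ ρ₁-largest m m-maximum =
  ρ₁≤m , mk⇔
    (λ ρ₁≈m → maximum-≤⇒regular (proj₁ ρ₁-largest) m-maximum (≈ᴿ⇒≥ᴿ ρ₁≈m))
    (λ (k , ρ≡k) → ≤ᴿ-antisym ρ₁≤m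
      (regular⇒maximum-≤ ρ≡k ρ₁-largest (proj₁ m-maximum)))
  where
  open Resistance G connected isInverse
  ρ₁≤m : ρ₁ ≤ᴿ m
  ρ₁≤m = eigenvalue-≤-maximum (proj₁ ρ₁-largest) m-maximum
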